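{- Let $A$ be a finite set, let $M$ be a commutative monoid and let $\phi:A^*\to M$ be a monoid homomorphism. The alternating $\phi$-conservative revital $ECons^\phi(A)$ is finitely generated, i.e. there is a finite set $P\subseteq B(A)$ with $\lceil P\rceil = ECons^\phi(A)$.
   Context: For a finite set $A$ and a positive integer $n$, $B_n(A)=\mathrm{Sym}(A^n)$ is the group of bijections $A^n\to A^n$ and $B(A)=\bigcup_n B_n(A)$; its elements are called gates. For $\alpha\in S_n$, the wire permutation is $\pi_\alpha(x_1,\dots,x_n)=(x_{\alpha^{ -1}(1)},\dots,x_{\alpha^{ -1}(n)})$; a rewiring of $f\in B_n(A)$ is $\pi_\alpha\circ f\circ\pi_\alpha^{ -1}$ for some $\alpha\in S_n$. For $f\in B_n(A)$, $g\in B_m(A)$, $f\oplus g\in B_{n+m}(A)$ applies $f$ to the first $n$ coordinates and $g$ to the last $m$; $\mathrm{id}_k$ is the identity of $A^k$. The extensions of $f\in B_\ell(A)$ on $A^n$, $n\ge\ell$, are the rewirings of $f\oplus \mathrm{id}_{n-\ell}$. For $P\subseteq B(A)$, $\lceil P\rceil\subseteq B(A)$ is the set of all gates obtained from $\mathrm{id}_1$ and the elements of $P$ by compositions of gates of equal arity and extensions. A set $C\subseteq B(A)$ with $C=\lceil C\rceil$ is called a revital. $A^*$ is the free monoid of words over $A$; $A^n$ is identified with the words of length $n$. The weight classes of $A^n$ under $\phi$ are the (non-empty) sets of words in $A^n$ having a common value under $\phi$. A gate $f\in B_n(A)$ is $\phi$-conservative if $\phi(f(x))=\phi(x)$ for all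 $x\in A^n$; such an $f$ permutes each weight class. $ECons^\phi(A)$ is the set of all $\phi$-conservative gates (of all arities) whose restriction to each weight class is an even permutation. -}

module Defs where

open import Level using (_⊔_)
open import Algebra.Bundles using (CommutativeMonoid)
open import Data.Bool.Base using (if_then_else_)
open import Data.Fin.Base using (Fin)
open import Data.Fin.Permutation using (Permutation′; _⟨$⟩ˡ_; inverseʳ; flip)
open import Data.Fin.Properties using (inj⇒≟)
open import Data.List.Base using (List; []; _∷_; length)
open import Data.Nat.Base using (ℕ; NonZero; _+_)
open import Data.Nat.Divisibility using (_∣_)
open import Data.Product using (Σ; ∃; _×_; _,_; uncurry)
open import Data.Product.Function.NonDependent.Propositional using (_×-↔_)
open import Data.Vec.Base using (Vec; _++_; take; drop; lookup; tabulate; cast; toList)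
open import Data.Vec.Properties
  using (≡-dec; take++drop≡id; ++-injective; lookup∘tabulate; tabulate∘lookup; tabulate-cong)
open import Function.Bundles using (_↔_; Inverse; mk↔ₛ′)
open import Function.Construct.Composition using (_↔-∘_)
open import Function.Construct.Identity using (↔-id)
open import Function.Construct.Symmetry using (↔-sym)
open import Function.Properties.Inverse using (↔⇒↣)
open import Relation.Binary.Definitions using (DecidableEquality)
open import Relation.Binary.PropositionalEquality
  using (_≡_; _≢_; refl; sym; trans; cong; cong₂)
open import Relation.Nullary.Decidable.Core using (does)
open import Relation.Unary using (Pred; _∈_)

Finite : ∀ {a} → Set a → Set a
Finite A = ∃ λ k → A ↔ Fin k

Finite⇒≟ : ∀ {a} {A : Set a} → Finite A → DecidableEquality A
Finite⇒≟ (_ , A↔Fin) = inj⇒≟ (↔⇒↣ A↔Fin)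

-- Sym (Aⁿ).  The case n = 0 is allowed here because f ⊕ id₀ occurs among
-- the extensions of f; gates have positive arity.
Bij : ∀ {a} → Set a → ℕ → Set a
Bij A n = Vec A n ↔ Vec A n

apply : ∀ {a} {A : Set a} {n} → Bij A n → Vec A n → Vec A n
apply = Inverse.to

id↔ : ∀ {a} {A : Set a} n → Bij A n
id↔ {A = A} n = ↔-id (Vec A n)

wire : ∀ {a} {A : Set a} {n} → Permutation′ n → Bij A n
wire α = mk↔ₛ′ (shuffle α) (shuffle (flip α)) (inverse α) (inverse (flip α))
  where
  shuffle : ∀ {a} {A : Set a} {n} → Permutation′ n → Vec A n → Vec A n
  shuffle β x = tabulate λ i → lookup x (β ⟨$⟩ˡ i)

  inverse : ∀ {a} {A : Set a} {n} (β : Permutation′ n) (x : Vec A n) →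
            shuffle β (shuffle (flip β) x) ≡ x
  inverse β x = trans
    (tabulate-cong λ i → trans (lookup∘tabulate _ (β ⟨$⟩ˡ i)) (cong (lookup x) (inverseʳ β)))
    (tabulate∘lookup x)

rewire : ∀ {a} {A : Set a} {n} → Permutation′ n → Bij A n → Bij A n
rewire α f = wire α ↔-∘ (f ↔-∘ ↔-sym (wire α))

++-↔ : ∀ {a} {A : Set a} m n → (Vec A m × Vec A n) ↔ Vec A (m + n)
++-↔ m n = mk↔ₛ′ (uncurry _++_) (λ z → take m z , drop m z) (take++drop≡id m) split-++
  where
  split-++ : ∀ p → (take m (uncurry _++_ p) , drop m (uncurry _++_ p)) ≡ p
  split-++ (x , y) with ++-injective (take m (x ++ y)) x (take++drop≡id m (x ++ y))
  ... | p , q = cong₂ _,_ p q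

infixr 6 _⊕_

_⊕_ : ∀ {a} {A : Set a} {m n} → Bij A m → Bij A n → Bij A (m + n)
_⊕_ {m = m} {n} f g = ++-↔ m n ↔-∘ ((f ×-↔ g) ↔-∘ ↔-sym (++-↔ m n))

record Gate {a} (A : Set a) : Set a where
  constructor gate
  field
    {arity}           : ℕ
    .{{arity-nonZero}} : NonZero arity
    bij               : Bij A arity

open Gate public using (arity; bij)

-- Equality of gates as functions on words of the same length.
infix 4 _≈ᴳ_

_≈ᴳ_ : ∀ {a} {A : Set a} → Gate A → Gate A → Set a
f ≈ᴳ g = Σ (arity f ≡ arity g) λ eq →
  ∀ x → cast eq (apply (bij f) x) ≡ apply (bij g) (cast eq x)

-- The constructor `resp` is needed because bijections with the same graph
-- need not be propositionally equal; it also identifies ℓ + 0 with ℓ.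
-- In `extend`, the second NonZero argument always follows from the first.
data ⌈_⌉ {a p} {A : Set a} (P : Pred (Gate A) p) : Pred (Gate A) (a ⊔ p) where
  id₁    : gate (id↔ 1) ∈ ⌈ P ⌉
  gen    : ∀ {f} → f ∈ P → f ∈ ⌈ P ⌉
  comp   : ∀ {n} .{{_ : NonZero n}} {f g : Bij A n} →
           gate f ∈ ⌈ P ⌉ → gate g ∈ ⌈ P ⌉ → gate (f ↔-∘ g) ∈ ⌈ P ⌉
  extend : ∀ {ℓ} k .{{_ : NonZero ℓ}} .{{_ : NonZero (ℓ + k)}} {f : Bij A ℓ}
           (α : Permutation′ (ℓ + k)) →
           gate f ∈ ⌈ P ⌉ → gate (rewire α (f ⊕ id↔ k)) ∈ ⌈ P ⌉
  resp   : ∀ {f g} → f ≈ᴳ g → f ∈ ⌈ P ⌉ → g ∈ ⌈ P ⌉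

module _ {x w} {X : Set x} (_≟_ : DecidableEquality X) (W : Pred X w) where

  record Transposition : Set (x ⊔ w) where
    field
      left right : X
      left∈W     : left ∈ W
      right∈W    : right ∈ W
      distinct   : left ≢ right

  transposeBy : Transposition → X → X
  transposeBy t y = if does (y ≟ left) then right
                    else if does (y ≟ right) then left
                    else y
    where open Transposition t

  product : List Transposition → X → X
  product []       y = y
  product (t ∷ ts) y = transposeBy t (product ts y)

  -- The restriction of f to W is a product of an even number of
  -- transpositions of elements of W.
  EvenOn : (X → X) → Set (x ⊔ w)
  EvenOn f = Σ (List Transposition) λ ts →
    2 ∣ length ts × (∀ y → y ∈ W → f y ≡ product ts y)

module _ {a c ℓ} {A : Set a} (M : CommutativeMonoid c ℓ)
         (φ : List A → CommutativeMonoid.Carrier M) where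

  open CommutativeMonoid M using (_≈_)

  weight : ∀ {n} → Vec A n → CommutativeMonoid.Carrier M
  weight x = φ (toList x)

  WeightClass : ∀ {n} → Vec A n → Pred (Vec A n) ℓ
  WeightClass x y = weight y ≈ weight x

  Conservative : Pred (Gate A) (a ⊔ ℓ)
  Conservative f = ∀ x → weight (apply (bij f) x) ≈ weight x

  -- Weight classes are non-empty, so they are indexed by representatives.
  ECons : DecidableEquality A → Pred (Gate A) (a ⊔ ℓ)
  ECons _≟_ f = Conservative f ×
    (∀ x → EvenOn (≡-dec _≟_) (WeightClass x) (apply (bij f)))

{-# OPTIONS --safe #-}

-- The generators are the 3-cycles of words of equal weight and bounded length: for
-- large n, every 3-cycle (x y z) in a weight class of Aⁿ is a product of extensions
-- of such 3-cycles of arity n − 1.  Let v, x, y, x′, y′ be distinct words of equal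
-- weight.  Extend (bv bx by) by a new first wire and (bv bx′ by′) by a new second
-- wire.  Both gates move bbv and no word besides it is moved by both, so their
-- commutator is the 3-cycle (bbv bbx bbx′).  This links any two words that share a
-- letter b on five wires and have equal weight on the other wires: moving a letter
-- d ≠ b among the shared b's supplies the three auxiliary words.  Since 3-cycles that
-- connect a set generate its alternating group, it remains to connect every weight
-- class of Aⁿ by such links, which is a case of Rédei's theorem on congruences of ℕᵏ.
-- Order the Parikh vectors lexicographically.  By Dickson's lemma there are finitely
-- many pairs b ≻ b′ of equal length and weight such that every Parikh vector that is
-- not minimal for its length and weight is of the form b + z.  If it is long, some
-- letter occurs five times in z, hence b + z is linked to the smaller b′ + z.

module Submission where

open import Defs
open import Level using (Level; _⊔_; Lift; lift; lower)
open import Algebra.Bundles using (CommutativeMonoid)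
open import Algebra.Morphism.Structures using (IsMonoidHomomorphism)
import Algebra.Properties.CommutativeMonoid.Sum as Sum
open import Axiom.ExcludedMiddle using (ExcludedMiddle)
open import Data.Bool.Base using (if_then_else_)
open import Data.Fin.Base using (zero; suc; splitAt)
open import Data.Fin.Permutation as Perm using (Permutation; Permutation′; _⟨$⟩ˡ_; ↔⇒≡)
open import Data.Fin.Properties using (+↔⊎)
open import Data.List.Base as List using (List; []; _∷_; length; ++-[]-rawMonoid)
open import Data.List.Membership.Propositional using (_∈_)
open import Data.List.Membership.Propositional.Properties
  using (∈-tabulate⁺; ∈-cartesianProductWith⁺; ∈-cartesianProduct⁺; ∈-concatMap⁺; ∈-concatMap⁻; ∈-upTo⁺)
import Data.List.Properties as List
open import Data.List.Relation.Binary.Permutation.Propositional as ↭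
  using (_↭_; prep; swap; ↭-trans; ↭-reflexive; ↭-sym; ↭-refl)
open import Data.List.Relation.Binary.Permutation.Propositional.Properties
  using (shift; shifts; ↭-length; ++⁺; ++⁺ˡ; map⁺; ++-assoc; Any-resp-↭)
open import Data.List.Relation.Unary.All as All using (All; []; _∷_)
import Data.List.Relation.Unary.All.Properties as All
open import Data.List.Relation.Unary.Any as Any using (Any; here; there)
import Data.List.Relation.Unary.Any.Properties as Any
open import Data.Nat.Base as ℕ using (ℕ; zero; suc; _+_; _*_; _∸_; _≤_; _<_; z≤n; s≤s; NonZero)
open import Data.Nat.Divisibility using (_∣_; _∣0; ∣1⇒≡1; ∣m+n∣m⇒∣n; ∣m∣n⇒∣m+n; ∣-refl)
open import Data.Nat.Induction using (<-wellFounded)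
import Data.Nat.Properties as ℕ
open import Data.Product using (∃; ∃₂; _×_; _,_; proj₁; proj₂)
open import Data.Sum.Base using (_⊎_; inj₁; inj₂)
open import Data.Sum.Properties using (swap-↔)
open import Data.Vec.Base as Vec
  using (Vec; []; _∷_; _++_; take; drop; lookup; tabulate; toList; fromList; zipWith; _[_]%=_)
open import Data.Vec.Properties
  using ( ≡-dec; cast-is-id; toList-injective; toList-map; toList-++; toList∘fromList; length-toList
        ; lookup∘tabulate; tabulate∘lookup; tabulate-cong; tabulate-∘; lookup-map
        ; lookup-splitAt; lookup-++ˡ; lookup-++ʳ; take++drop≡id; ++-injective; ++-injectiveˡ; ∷-injectiveʳ)
open import Data.Vec.Relation.Binary.Lex.Strict as Lex using (Lex-<; this; next)
open import Data.Vec.Relation.Binary.Pointwise.Inductive using (Pointwise-≡⇒≡)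
open import Function.Base using (id; _∘_)
open import Function.Bundles using (Inverse; mk↔ₛ′)
open import Function.Construct.Composition using (_↔-∘_)
open import Function.Construct.Symmetry using (↔-sym)
open import Induction.WellFounded using (Acc; acc; WellFounded)
open import Relation.Binary.Construct.Closure.Equivalence as EqClosure using (EqClosure)
open import Relation.Binary.Construct.Closure.ReflexiveTransitive using (ε; _◅_; _◅◅_)
open import Relation.Binary.Construct.Closure.Symmetric using (SymClosure; fwd; bwd)
open import Relation.Binary.Core using (Rel)
open import Relation.Binary.Definitions using (DecidableEquality; Decidable; tri<; tri≈; tri>)
open import Relation.Binary.PropositionalEquality as ≡
  using (_≡_; _≢_; _≗_; refl; sym; trans; cong; cong₂; subst; subst₂)
open import Relation.Binary.Structures using (IsEquivalence)
open import Relation.Nullary using (¬_; Dec; yes; no; does; contradiction; ¬?; _×-dec_; _⊎-dec_)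
open import Relation.Nullary.Decidable using (map′)
open import Relation.Unary using (Pred; _≐_)

private variable
  s w : Level
  k m n : ℕ

-- Submonoids of self-maps; transpositions and 3-cycles.

record IsClosed {x} {X : Set x} (S : Pred (X → X) s) : Set (x ⊔ s) where
  field
    id∈   : S id
    ∘∈    : ∀ {f g} → S f → S g → S (f ∘ g)
    resp∈ : ∀ {f g} → f ≗ g → S f → S g

module Cycles {x} {X : Set x} (_≟_ : DecidableEquality X) where

  transposition : X → X → X → X
  transposition a b y = if does (y ≟ a) then b else if does (y ≟ b) then a else y

  record Distinct (a b c : X) : Set x where
    constructor distinct
    field
      1≢2 : a ≢ b
      2≢3 : b ≢ c
      1≢3 : a ≢ c

  transposition-left : ∀ a b → transposition a b a ≡ b
  transposition-left a b with a ≟ a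
  ... | yes _   = refl
  ... | no  a≢a = contradiction refl a≢a

  transposition-right : ∀ a b → transposition a b b ≡ a
  transposition-right a b with b ≟ a
  ... | yes b≡a = b≡a
  ... | no  _ with b ≟ b
  ...   | yes _   = refl
  ...   | no  b≢b = contradiction refl b≢b

  transposition-other : ∀ {a b y} → y ≢ a → y ≢ b → transposition a b y ≡ y
  transposition-other {a} {b} {y} y≢a y≢b with y ≟ a
  ... | yes y≡a = contradiction y≡a y≢a
  ... | no  _ with y ≟ b
  ...   | yes y≡b = contradiction y≡b y≢b
  ...   | no  _   = refl

  transposition-involutive : ∀ a b y → transposition a b (transposition a b y) ≡ y
  transposition-involutive a b y with y ≟ a
  ... | yes refl = transposition-right y b
  ... | no  y≢a with y ≟ b
  ...   | yes refl = transposition-left a y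
  ...   | no  y≢b  = transposition-other y≢a y≢b

  transposition-comm : ∀ a b → transposition a b ≗ transposition b a
  transposition-comm a b y with y ≟ a | y ≟ b
  ... | yes refl | yes refl = refl
  ... | yes _    | no  _    = refl
  ... | no  _    | yes _    = refl
  ... | no  _    | no  _    = refl

  opaque
    -- For distinct points this is a ↦ b ↦ c ↦ a. It is opaque so that goals keep `cycle` instead of
    -- nested equality tests.
    cycle : X → X → X → X → X
    cycle a b c = transposition a b ∘ transposition b c

    cycle≗transpositions : ∀ a b c → cycle a b c ≗ transposition a b ∘ transposition b c
    cycle≗transpositions a b c y = refl

    cycle-first : ∀ {a b c} → Distinct a b c → cycle a b c a ≡ b
    cycle-first {a} {b} (distinct a≢b b≢c a≢c) =
      trans (cong (transposition a b) (transposition-other a≢b a≢c)) (transposition-left a b)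

    cycle-second : ∀ {a b c} → Distinct a b c → cycle a b c b ≡ c
    cycle-second {a} {b} {c} (distinct a≢b b≢c a≢c) =
      trans (cong (transposition a b) (transposition-left b c))
            (transposition-other (a≢c ∘ sym) (b≢c ∘ sym))

    cycle-third : ∀ {a b c} → Distinct a b c → cycle a b c c ≡ a
    cycle-third {a} {b} {c} _ =
      trans (cong (transposition a b) (transposition-right b c)) (transposition-right a b)

    cycle-other : ∀ {a b c y} → y ≢ a → y ≢ b → y ≢ c → cycle a b c y ≡ y
    cycle-other {a} {b} y≢a y≢b y≢c =
      trans (cong (transposition a b) (transposition-other y≢b y≢c)) (transposition-other y≢a y≢b)

  open Distinct

  rotate : ∀ {a b c} → Distinct a b c → Distinct b c a
  rotate (distinct a≢b b≢c a≢c) = distinct b≢c (a≢c ∘ sym) (a≢b ∘ sym)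

  reflect : ∀ {a b c} → Distinct a b c → Distinct a c b
  reflect (distinct a≢b b≢c a≢c) = distinct a≢c (b≢c ∘ sym) a≢b

  module _ {a b c} (d : Distinct a b c) where

    cycle-unique : {f : X → X} → f a ≡ b → f b ≡ c → f c ≡ a →
                   (∀ y → y ≢ a → y ≢ b → y ≢ c → f y ≡ y) → f ≗ cycle a b c
    cycle-unique {f} fa fb fc fy y = by-cases (y ≟ a) (y ≟ b) (y ≟ c)
      where
      by-cases : Dec (y ≡ a) → Dec (y ≡ b) → Dec (y ≡ c) → f y ≡ cycle a b c y
      by-cases (yes refl) _          _          = trans fa (sym (cycle-first d))
      by-cases _          (yes refl) _          = trans fb (sym (cycle-second d))
      by-cases _          _          (yes refl) = trans fc (sym (cycle-third d))
      by-cases (no y≢a)   (no y≢b)   (no y≢c)   =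
        trans (fy y y≢a y≢b y≢c) (sym (cycle-other y≢a y≢b y≢c))

    Distinct-map : {h h⁻¹ : X → X} → h⁻¹ ∘ h ≗ id → Distinct (h a) (h b) (h c)
    Distinct-map {h} {h⁻¹} h⁻¹h =
      distinct (inj (1≢2 d)) (inj (2≢3 d)) (inj (1≢3 d))
      where
      inj : ∀ {y z} → y ≢ z → h y ≢ h z
      inj y≢z hy≡hz = y≢z (trans (sym (h⁻¹h _)) (trans (cong h⁻¹ hy≡hz) (h⁻¹h _)))

  module _ {a b c} (d : Distinct a b c) where

    cycle-conjugate : {h h⁻¹ : X → X} → h ∘ h⁻¹ ≗ id → h⁻¹ ∘ h ≗ id →
                      h ∘ cycle a b c ∘ h⁻¹ ≗ cycle (h a) (h b) (h c)
    cycle-conjugate {h} {h⁻¹} hh⁻¹ h⁻¹h = cycle-unique (Distinct-map d {h} {h⁻¹} h⁻¹h)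
      (cong h (trans (cong (cycle a b c) (h⁻¹h a)) (cycle-first d)))
      (cong h (trans (cong (cycle a b c) (h⁻¹h b)) (cycle-second d)))
      (cong h (trans (cong (cycle a b c) (h⁻¹h c)) (cycle-third d)))
      λ y y≢ha y≢hb y≢hc →
        trans (cong h (cycle-other (y≢ha ∘ to) (y≢hb ∘ to) (y≢hc ∘ to))) (hh⁻¹ y)
      where
      to : ∀ {y z} → h⁻¹ y ≡ z → y ≡ h z
      to refl = sym (hh⁻¹ _)

    cycle-inverse : cycle a b c ∘ cycle a c b ≗ id
    cycle-inverse y =
      trans (cong (cycle a b c) (cycle-reverse y)) (trans (cycle≗transpositions a b c _)
      (trans (cong (transposition a b) (transposition-involutive b c _))
             (transposition-involutive a b y)))
      where
      cycle-reverse : cycle a c b ≗ transposition b c ∘ transposition a b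
      cycle-reverse y = sym (cycle-unique (reflect d)
        (trans (cong (transposition b c) (transposition-left a b)) (transposition-left b c))
        (trans (cong (transposition b c) (transposition-other (1≢3 d ∘ sym) (2≢3 d ∘ sym)))
               (transposition-right b c))
        (trans (cong (transposition b c) (transposition-right a b))
               (transposition-other (1≢2 d) (1≢3 d)))
        (λ y y≢a y≢c y≢b → trans (cong (transposition b c) (transposition-other y≢a y≢b))
                                 (transposition-other y≢b y≢c)) y)

    cycle-rotate : cycle a b c ≗ cycle b c a
    cycle-rotate = cycle-unique (rotate d)
      (cycle-second d) (cycle-third d) (cycle-first d)
      (λ y y≢b y≢c y≢a → cycle-other y≢a y≢b y≢c)

    cycle-square : cycle a b c ∘ cycle a b c ≗ cycle a c b
    cycle-square = cycle-unique (reflect d)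
      (trans (cong (cycle a b c) (cycle-first d)) (cycle-second d))
      (trans (cong (cycle a b c) (cycle-third d)) (cycle-first d))
      (trans (cong (cycle a b c) (cycle-second d)) (cycle-third d))
      (λ y y≢a y≢c y≢b → trans (cong (cycle a b c) (cycle-other y≢a y≢b y≢c)) (cycle-other y≢a y≢b y≢c))

  cycle-closed : ∀ {W : Pred X w} {a b c} → W a → W b → W c → ∀ {y} → W y → W (cycle a b c y)
  cycle-closed {W = W} {a} {b} {c} Wa Wb Wc {y} Wy =
    subst W (sym (cycle≗transpositions a b c y)) (closed Wa Wb (closed Wb Wc Wy))
    where
    closed : ∀ {a b y} → W a → W b → W y → W (transposition a b y)
    closed {a} {b} {y} Wa Wb Wy with y ≟ a
    ... | yes _ = Wb
    ... | no  _ with y ≟ b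
    ...   | yes _ = Wa
    ...   | no  _ = Wy

  -- The supports of f and g meet only in y. Since f y is moved by f and differs from y, it is fixed
  -- by g; likewise f fixes g y. Any z other than y, f y and g y is moved by at most one of the two
  -- maps. Its preimage under that map is not y, hence is fixed by the other map, so the map cancels
  -- against its inverse.
  commutator-cycle : {f f⁻¹ g g⁻¹ : X → X} →
    f ∘ f⁻¹ ≗ id → f⁻¹ ∘ f ≗ id → g ∘ g⁻¹ ≗ id → g⁻¹ ∘ g ≗ id →
    ∀ {y} → f y ≢ y → g y ≢ y → (∀ z → f z ≡ z ⊎ g z ≡ z ⊎ z ≡ y) →
    Distinct y (f y) (g y) × f ∘ g ∘ f⁻¹ ∘ g⁻¹ ≗ cycle y (f y) (g y)
  commutator-cycle {f} {f⁻¹} {g} {g⁻¹} ff⁻¹ f⁻¹f gg⁻¹ g⁻¹g {y} fy≢y gy≢y meet =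
    y-fy-gy , cycle-unique y-fy-gy at-y at-fy at-gy elsewhere
    where
    f-inj : ∀ {u v} → f u ≡ f v → u ≡ v
    f-inj p = trans (sym (f⁻¹f _)) (trans (cong f⁻¹ p) (f⁻¹f _))

    g-inj : ∀ {u v} → g u ≡ g v → u ≡ v
    g-inj p = trans (sym (g⁻¹g _)) (trans (cong g⁻¹ p) (g⁻¹g _))

    f⁻¹-fix : ∀ {u} → f u ≡ u → f⁻¹ u ≡ u
    f⁻¹-fix p = f-inj (trans (ff⁻¹ _) (sym p))

    g⁻¹-fix : ∀ {u} → g u ≡ u → g⁻¹ u ≡ u
    g⁻¹-fix p = g-inj (trans (gg⁻¹ _) (sym p))

    f-moved : ∀ {u} → f u ≢ u → u ≢ y → g u ≡ u
    f-moved {u} fu≢u u≢y with meet u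
    ... | inj₁ p        = contradiction p fu≢u
    ... | inj₂ (inj₁ p) = p
    ... | inj₂ (inj₂ p) = contradiction p u≢y

    g-moved : ∀ {u} → g u ≢ u → u ≢ y → f u ≡ u
    g-moved {u} gu≢u u≢y with meet u
    ... | inj₁ p        = p
    ... | inj₂ (inj₁ p) = contradiction p gu≢u
    ... | inj₂ (inj₂ p) = contradiction p u≢y

    g-fixes-fy : g (f y) ≡ f y
    g-fixes-fy = f-moved (fy≢y ∘ f-inj) fy≢y

    f-fixes-gy : f (g y) ≡ g y
    f-fixes-gy = g-moved (gy≢y ∘ g-inj) gy≢y

    y-fy-gy : Distinct y (f y) (g y)
    y-fy-gy = distinct (fy≢y ∘ sym)
      (λ p → fy≢y (f-inj (trans (cong f p) (trans f-fixes-gy (sym p)))))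
      (gy≢y ∘ sym)

    f⁻¹y≢y : f⁻¹ y ≢ y
    f⁻¹y≢y p = fy≢y (trans (cong f (sym p)) (ff⁻¹ y))

    g⁻¹y≢y : g⁻¹ y ≢ y
    g⁻¹y≢y p = gy≢y (trans (cong g (sym p)) (gg⁻¹ y))

    at-y : f (g (f⁻¹ (g⁻¹ y))) ≡ f y
    at-y = cong f (trans (cong g (f⁻¹-fix f-fixes)) (gg⁻¹ y))
      where
      f-fixes : f (g⁻¹ y) ≡ g⁻¹ y
      f-fixes = g-moved (λ p → g⁻¹y≢y (sym (trans (sym (gg⁻¹ y)) p))) g⁻¹y≢y

    at-fy : f (g (f⁻¹ (g⁻¹ (f y)))) ≡ g y
    at-fy = trans (cong (f ∘ g) (trans (cong f⁻¹ (g⁻¹-fix g-fixes-fy)) (f⁻¹f y))) f-fixes-gy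

    at-gy : f (g (f⁻¹ (g⁻¹ (g y)))) ≡ y
    at-gy = trans (cong (f ∘ g ∘ f⁻¹) (g⁻¹g y)) (trans (cong f g-fixes) (ff⁻¹ y))
      where
      g-fixes : g (f⁻¹ y) ≡ f⁻¹ y
      g-fixes = f-moved (λ p → f⁻¹y≢y (sym (trans (sym (ff⁻¹ y)) p))) f⁻¹y≢y

    elsewhere : ∀ z → z ≢ y → z ≢ f y → z ≢ g y → f (g (f⁻¹ (g⁻¹ z))) ≡ z
    elsewhere z z≢y z≢fy z≢gy with g z ≟ z
    ... | yes gz≡z = trans (cong f (trans (cong (g ∘ f⁻¹) (g⁻¹-fix gz≡z)) g-fixes)) (ff⁻¹ z)
      where
      g-fixes : g (f⁻¹ z) ≡ f⁻¹ z
      g-fixes with f z ≟ z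
      ... | yes fz≡z = subst (λ u → g u ≡ u) (sym (f⁻¹-fix fz≡z)) gz≡z
      ... | no  fz≢z = f-moved
        (λ p → fz≢z (trans (cong f (trans (sym (ff⁻¹ z)) p)) (ff⁻¹ z)))
        (λ p → z≢fy (trans (sym (ff⁻¹ z)) (cong f p)))
    ... | no gz≢z = trans (cong f (trans (cong g (f⁻¹-fix f-fixes)) (gg⁻¹ z))) fz≡z
      where
      fz≡z : f z ≡ z
      fz≡z = g-moved gz≢z z≢y

      f-fixes : f (g⁻¹ z) ≡ g⁻¹ z
      f-fixes = g-moved
        (λ p → gz≢z (trans (cong g (trans (sym (gg⁻¹ z)) p)) (gg⁻¹ z)))
        (λ p → z≢gy (trans (sym (gg⁻¹ z)) (cong g p)))

-- 3-cycles that generate an alternating group.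

module Closed {x} {X : Set x} (_≟_ : DecidableEquality X)
              {S : Pred (X → X) s} (S-closed : IsClosed S) where
  open Cycles _≟_
  open Distinct
  open IsClosed S-closed

  -- The inverse of (p q r) is its square, so conjugation is available from composition alone.
  conjugate∈ : ∀ {a b c p q r} → Distinct a b c → Distinct p q r →
               S (cycle a b c) → S (cycle p q r) →
               let σ = cycle p q r in S (cycle (σ a) (σ b) (σ c))
  conjugate∈ {a} {b} {c} {p} {q} {r} d e abc∈ pqr∈ =
    resp∈ (cycle-conjugate d {cycle p q r} {cycle p r q} (cycle-inverse e) (cycle-inverse (reflect e)))
      (∘∈ pqr∈ (∘∈ abc∈ (resp∈ (cycle-square e) (∘∈ pqr∈ pqr∈))))

  reflect∈ : ∀ {a b c} → Distinct a b c → S (cycle a b c) → S (cycle a c b)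
  reflect∈ d abc∈ = resp∈ (cycle-square d) (∘∈ abc∈ abc∈)

  rotate∈ : ∀ {a b c} → Distinct a b c → S (cycle a b c) → S (cycle b c a)
  rotate∈ d = resp∈ (cycle-rotate d)

  module _ (W : Pred X w) where

    -- The third point lies in `W` so that it can be linked in turn, as `linked⇒cycle∈` does.
    Linked : Rel X (x ⊔ s ⊔ w)
    Linked a b = a ≡ b ⊎ ∃ λ c → W c × Distinct a b c × S (cycle a b c)

    Linked-sym : ∀ {a b} → Linked a b → Linked b a
    Linked-sym (inj₁ a≡b)               = inj₁ (sym a≡b)
    Linked-sym (inj₂ (c , Wc , d , abc∈)) =
      inj₂ (c , Wc , rotate (rotate (reflect d)) ,
            rotate∈ (rotate (reflect d)) (rotate∈ (reflect d) (reflect∈ d abc∈)))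

    -- Conjugation by (b c q) turns (a b p) into a cycle through a and c, because it takes b to c
    -- and fixes a. The exception a = q is harmless, since then (b c q) itself passes through a and
    -- c.
    Linked-trans : ∀ {a b c} → W b → W c → Linked a b → Linked b c → Linked a c
    Linked-trans Wb Wc (inj₁ refl) bc = bc
    Linked-trans Wb Wc ab (inj₁ refl) = ab
    Linked-trans {a} {b} {c} Wb Wc (inj₂ (p , Wp , d , abp∈)) (inj₂ (q , Wq , e , bcq∈)) =
      by-cases (a ≟ c) (a ≟ q)
      where
      σ = cycle b c q

      by-cases : Dec (a ≡ c) → Dec (a ≡ q) → Linked a c
      by-cases (yes a≡c) _ = inj₁ a≡c
      by-cases (no _) (yes refl) =
        inj₂ (b , Wb , reflect (rotate (rotate e))
                     , reflect∈ (rotate (rotate e)) (rotate∈ (rotate e) (rotate∈ e bcq∈)))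
      by-cases (no a≢c) (no a≢q) =
        inj₂ (σ p , cycle-closed {W = W} Wb Wc Wq Wp
             , subst₂ (λ u v → Distinct u v (σ p)) σa σb
                 (Distinct-map d {σ} {cycle b q c} (cycle-inverse (reflect e)))
             , subst₂ (λ u v → S (cycle u v (σ p))) σa σb (conjugate∈ d e abp∈ bcq∈))
        where
        σa : σ a ≡ a
        σa = cycle-other (1≢2 d) a≢c a≢q

        σb : σ b ≡ c
        σb = cycle-first e

    -- From (a b s), conjugation by a 3-cycle that moves s to c gives (a b c),
    -- unless that 3-cycle also moves a or b.
    linked⇒cycle∈ : (∀ {a b} → W a → W b → Linked a b) →
                    ∀ {a b c} → W a → W b → W c → Distinct a b c → S (cycle a b c)
    linked⇒cycle∈ linked {a} {b} {c} Wa Wb Wc d@(distinct a≢b b≢c a≢c) with linked Wa Wb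
    ... | inj₁ a≡b = contradiction a≡b a≢b
    ... | inj₂ (s , Ws , d₁@(distinct _ b≢s a≢s) , abs∈) with linked Ws Wc
    ...   | inj₁ refl = abs∈
    ...   | inj₂ (r , Wr , d₂ , scr∈) = by-cases (r ≟ a) (r ≟ b)
      where
      s≢c = 1≢2 d₂

      to-≡ : ∀ {u v w u′ v′ w′} → u ≡ u′ → v ≡ v′ → w ≡ w′ → S (cycle u v w) → S (cycle u′ v′ w′)
      to-≡ refl refl refl p = p

      by-cases : Dec (r ≡ a) → Dec (r ≡ b) → S (cycle a b c)
      by-cases (yes refl) _ = reflect∈ (reflect d)
        (to-≡ (cycle-third d₁) (cycle-other (a≢c ∘ sym) (b≢c ∘ sym) (s≢c ∘ sym)) (cycle-first d₁)
          (conjugate∈ d₂ d₁ scr∈ abs∈))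
      by-cases (no _) (yes refl) = rotate∈ (rotate (rotate d)) (rotate∈ (rotate d)
        (to-≡ (cycle-second (reflect d₁)) (cycle-other (a≢c ∘ sym) (s≢c ∘ sym) (b≢c ∘ sym))
              (cycle-third (reflect d₁))
          (conjugate∈ d₂ (reflect d₁) scr∈ (reflect∈ d₁ abs∈))))
      by-cases (no r≢a) (no r≢b) =
        to-≡ (cycle-other a≢s a≢c (r≢a ∘ sym)) (cycle-other b≢s b≢c (r≢b ∘ sym)) (cycle-first d₂)
          (conjugate∈ d₁ d₂ abs∈ scr∈)

    module _ (cycle∈ : ∀ {a b c} → W a → W b → W c → Distinct a b c → S (cycle a b c)) where

      adjacent∈ : ∀ {a b c} → W a → W b → W c → a ≢ b → b ≢ c →
                  S (transposition a b ∘ transposition b c)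
      adjacent∈ {a} {b} {c} Wa Wb Wc a≢b b≢c with a ≟ c
      ... | yes refl = resp∈ (λ y → sym (trans (cong (transposition a b) (transposition-comm b a y))
                                            (transposition-involutive a b y))) id∈
      ... | no  a≢c  = resp∈ (cycle≗transpositions a b c) (cycle∈ Wa Wb Wc (distinct a≢b b≢c a≢c))

      -- (a b)(c d) = (a b)(b c) · (b c)(c d)
      transpositions∈ : ∀ {a b c d} → W a → W b → W c → W d → a ≢ b → c ≢ d →
                        S (transposition a b ∘ transposition c d)
      transpositions∈ {a} {b} {c} {d} Wa Wb Wc Wd a≢b c≢d with b ≟ c
      ... | yes refl = adjacent∈ Wa Wb Wd a≢b c≢d
      ... | no  b≢c  = resp∈ (λ y → cong (transposition a b) (transposition-involutive b c _))
                         (∘∈ (adjacent∈ Wa Wb Wc a≢b b≢c) (adjacent∈ Wb Wc Wd b≢c c≢d))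

      product∈ : ∀ ts → 2 ∣ length ts → S (product _≟_ W ts)
      product∈ []           _   = id∈
      product∈ (_ ∷ [])     2∣1 = contradiction (∣1⇒≡1 2∣1) λ ()
      product∈ (t ∷ u ∷ ts) 2∣n =
        ∘∈ (transpositions∈ T.left∈W T.right∈W U.left∈W U.right∈W T.distinct U.distinct)
           (product∈ ts (∣m+n∣m⇒∣n {2} {2} 2∣n ∣-refl))
        where
        module T = Transposition t
        module U = Transposition u

product-outside : ∀ {x} {X : Set x} (_≟_ : DecidableEquality X) (W : Pred X w) ts {y} →
                  ¬ W y → product _≟_ W ts y ≡ y
product-outside _≟_ W []       ¬Wy = refl
product-outside _≟_ W (t ∷ ts) {y} ¬Wy =
  trans (cong (transposeBy _≟_ W t) (product-outside _≟_ W ts ¬Wy))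
        (transposition-other (λ { refl → ¬Wy left∈W }) (λ { refl → ¬Wy right∈W }))
  where
  open Cycles _≟_
  open Transposition t

-- Maps that preserve the blocks of an equivalence relation.

module Blocks {x k r} {X : Set x} {K : Set k} {_∼_ : Rel K r}
              (isEquivalence : IsEquivalence _∼_) (_∼?_ : Decidable _∼_) (κ : X → K) where

  private module E = IsEquivalence isEquivalence

  restrict : (X → X) → K → X → X
  restrict f k y = if does (κ y ∼? k) then f y else y

  module _ {S : Pred (X → X) s} (S-closed : IsClosed S)
           {f : X → X} (f-preserves : ∀ y → κ (f y) ∼ κ y) where
    open IsClosed S-closed

    restrictAll : List K → X → X
    restrictAll ks y = if does (Any.any? (κ y ∼?_) ks) then f y else y

    -- A block that is already listed changes nothing. For a new block the restriction is composed
    -- with the previous ones; as f maps each block into itself, no point is moved by two of the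
    -- factors, and f is applied only once.
    restrictAll∈ : (∀ k → S (restrict f k)) → ∀ ks → S (restrictAll ks)
    restrictAll∈ restrict∈ []       = id∈
    restrictAll∈ restrict∈ (k ∷ ks) with Any.any? (k ∼?_) ks
    ... | yes k∈ks = resp∈ agree (restrictAll∈ restrict∈ ks)
      where
      agree : restrictAll ks ≗ restrictAll (k ∷ ks)
      agree y with κ y ∼? k | Any.any? (κ y ∼?_) ks
      ... | yes _   | yes _   = refl
      ... | yes y∼k | no  y∉ks = contradiction (Any.map (E.trans y∼k) k∈ks) y∉ks
      ... | no  _   | yes _   = refl
      ... | no  _   | no  _   = refl
    ... | no  k∉ks = resp∈ agree (∘∈ (restrict∈ k) (restrictAll∈ restrict∈ ks))
      where
      fixed : ∀ y → ¬ κ y ∼ k → restrict f k y ≡ y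
      fixed y y≁k with κ y ∼? k
      ... | yes y∼k = contradiction y∼k y≁k
      ... | no  _   = refl

      agree : restrict f k ∘ restrictAll ks ≗ restrictAll (k ∷ ks)
      agree y with Any.any? (κ y ∼?_) ks
      agree y | yes y∈ks with κ y ∼? k
      ... | yes y∼k = contradiction (Any.map (E.trans (E.sym y∼k)) y∈ks) k∉ks
      ... | no  y≁k = fixed (f y) (λ fy∼k → y≁k (E.trans (E.sym (f-preserves y)) fy∼k))
      agree y | no _ with κ y ∼? k
      ... | yes y∼k = refl
      ... | no  y≁k = refl

    restrict∈⇒∈ : (∀ k → S (restrict f k)) → ∀ ks → (∀ y → Any (κ y ∼_) ks) → S f
    restrict∈⇒∈ restrict∈ ks complete = resp∈ agree (restrictAll∈ restrict∈ ks)
      where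
      agree : restrictAll ks ≗ f
      agree y with Any.any? (κ y ∼?_) ks
      ... | yes _    = refl
      ... | no  y∉ks = contradiction (complete y) y∉ks

-- Maps realised by gates of a revital.

module _ {a} {A : Set a} where

  -- The formula of `wire`, but between index sets whose sizes need not agree definitionally. This
  -- takes the place of casts such as the one between n + 0 and n.
  shuffle : Permutation m n → Vec A m → Vec A n
  shuffle π x = tabulate λ i → lookup x (π ⟨$⟩ˡ i)

  shuffle-∘ : (π : Permutation m n) (ρ : Permutation n k) (x : Vec A m) →
              shuffle (π Perm.∘ₚ ρ) x ≡ shuffle ρ (shuffle π x)
  shuffle-∘ π ρ x = tabulate-cong λ i → sym (lookup∘tabulate _ (ρ ⟨$⟩ˡ i))

  exchange : ∀ m n → Permutation (m + n) (n + m)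
  exchange m n = ↔-sym (+↔⊎ {n} {m}) ↔-∘ (swap-↔ ↔-∘ +↔⊎ {m} {n})

  shuffle-exchange : (x : Vec A m) (y : Vec A n) → shuffle (exchange m n) (x ++ y) ≡ y ++ x
  shuffle-exchange {m} {n} x y = trans (tabulate-cong pointwise) (tabulate∘lookup (y ++ x))
    where
    pointwise : ∀ i → lookup (x ++ y) (exchange m n ⟨$⟩ˡ i) ≡ lookup (y ++ x) i
    pointwise i rewrite lookup-splitAt n y x i with splitAt n i
    ... | inj₁ j = lookup-++ʳ x y j
    ... | inj₂ j = lookup-++ˡ x y j

  take-drop-++ : (x : Vec A m) (y : Vec A n) → take m (x ++ y) ≡ x × drop m (x ++ y) ≡ y
  take-drop-++ {m} x y = ++-injective (take m (x ++ y)) x (take++drop≡id m (x ++ y))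

  onPrefix : (Vec A m → Vec A m) → Vec A (m + n) → Vec A (m + n)
  onPrefix {m} f y = f (take m y) ++ drop m y

  onPrefix-++ : (f : Vec A m → Vec A m) (x : Vec A m) (y : Vec A n) → onPrefix f (x ++ y) ≡ f x ++ y
  onPrefix-++ f x y = cong₂ (λ u v → f u ++ v) (proj₁ (take-drop-++ x y)) (proj₂ (take-drop-++ x y))

  module _ {p} {P : Pred (Gate A) p} where

    Realised : .{{NonZero n}} → Pred (Vec A n → Vec A n) (a ⊔ p)
    Realised {n} f = ∃ λ (b : Bij A n) → ⌈ P ⌉ (gate b) × apply b ≗ f

    realised⇒∈ : .{{_ : NonZero n}} (b : Bij A n) → Realised (apply b) → ⌈ P ⌉ (gate b)
    realised⇒∈ b (b′ , b′∈ , b′≗b) =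
      resp (refl , λ x → trans (cast-is-id refl _) (trans (b′≗b x) (cong (apply b) (sym (cast-is-id refl x))))) b′∈

    -- The permutation `π` forces n = m + k. After this identification it is a wire permutation and
    -- the map is an extension.
    realised-extend : ∀ {m n k} .{{_ : NonZero m}} .{{_ : NonZero n}} (π : Permutation (m + k) n) {f : Vec A m → Vec A m} →
                      Realised f → Realised (shuffle π ∘ onPrefix f ∘ shuffle (Perm.flip π))
    realised-extend {m} {n} {k} π {f} (b , b∈ , b≗f) with ↔⇒≡ π
    ... | refl = _ , extend k π b∈ , λ x → cong (λ u → shuffle π (u ++ drop m _)) (b≗f _)

    realised-closed : .{{_ : NonZero n}} → IsClosed (Realised {n})
    realised-closed {suc n} = record
      { id∈   = _ , extend n Perm.id id₁ , λ x → trans (trans (tabulate∘lookup _) (take++drop≡id 1 _)) (tabulate∘lookup x)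
      ; ∘∈    = λ (b , b∈ , b≗f) (b′ , b′∈ , b′≗g) → _ , comp b∈ b′∈ , λ x → trans (cong (apply b) (b′≗g x)) (b≗f _)
      ; resp∈ = λ f≗g (b , b∈ , b≗f) → b , b∈ , λ x → trans (b≗f x) (f≗g x)
      }

    -- `extend` puts the new wire last; `exchange` brings it to the front.
    realised-tail : .{{_ : NonZero n}} {f : Vec A n → Vec A n} {h : Vec A (suc n) → Vec A (suc n)} →
                    (∀ c x → h (c ∷ x) ≡ c ∷ f x) → Realised f → Realised h
    realised-tail {n} {f} {h} h≗ f∈ =
      IsClosed.resp∈ realised-closed agree (realised-extend {k = 1} (exchange n 1) f∈)
      where
      agree : shuffle (exchange n 1) ∘ onPrefix f ∘ shuffle (exchange 1 n) ≗ h
      agree (c ∷ x) = trans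
        (cong (shuffle (exchange n 1)) (trans (cong (onPrefix f) (shuffle-exchange (c ∷ []) x)) (onPrefix-++ f x (c ∷ []))))
        (trans (shuffle-exchange (f x) (c ∷ [])) (sym (h≗ c x)))

    -- A rewiring is an extension by no wires, with `exchange n 0` leading from n + 0 to n.
    realised-rewire : .{{_ : NonZero n}} (α : Permutation′ n) {f : Vec A n → Vec A n} →
                      Realised f → Realised (apply (wire α) ∘ f ∘ Inverse.from (wire α))
    realised-rewire {n} α {f} f∈ = IsClosed.resp∈ realised-closed agree (realised-extend {k = 0} π f∈)
      where
      π : Permutation (n + 0) n
      π = exchange n 0 Perm.∘ₚ α

      from : ∀ x → shuffle (Perm.flip π) x ≡ shuffle (Perm.flip α) x ++ []
      from x = trans (shuffle-∘ (Perm.flip α) (exchange 0 n) x) (shuffle-exchange [] (shuffle (Perm.flip α) x))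

      agree : shuffle π ∘ onPrefix f ∘ shuffle (Perm.flip π) ≗ shuffle α ∘ f ∘ shuffle (Perm.flip α)
      agree x = trans (cong (shuffle π) (trans (cong (onPrefix f) (from x)) (onPrefix-++ f (shuffle (Perm.flip α) x) [])))
        (trans (shuffle-∘ (exchange n 0) α (y ++ [])) (cong (shuffle α) (shuffle-exchange y [])))
        where
        y : Vec A n
        y = f (shuffle (Perm.flip α) x)

-- Enumeration and permutation of words.

wordsOfLength : ∀ {a} {A : Set a} → List A → ∀ n → List (Vec A n)
wordsOfLength as zero    = [] ∷ []
wordsOfLength as (suc n) = List.cartesianProductWith _∷_ as (wordsOfLength as n)

∈-wordsOfLength : ∀ {a} {A : Set a} {as : List A} → (∀ x → x ∈ as) → (y : Vec A n) → y ∈ wordsOfLength as n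
∈-wordsOfLength x∈as []      = here refl
∈-wordsOfLength x∈as (x ∷ y) = ∈-cartesianProductWith⁺ _∷_ (x∈as x) (∈-wordsOfLength x∈as y)

letters : ∀ {a} {A : Set a} → Finite A → List A
letters (k , A↔Fin) = List.tabulate (Inverse.from A↔Fin)

∈-letters : ∀ {a} {A : Set a} (finite : Finite A) x → x ∈ letters finite
∈-letters (k , A↔Fin) x = subst (_∈ List.tabulate from) (strictlyInverseʳ x) (∈-tabulate⁺ (to x))
  where open Inverse A↔Fin

↭⇒shuffle : ∀ {b} {B : Set b} {xs ys : List B} → xs ↭ ys →
            ∃ λ (π : Permutation (length ys) (length xs)) → shuffle π (fromList ys) ≡ fromList xs
↭⇒shuffle ↭.refl = Perm.id , tabulate∘lookup _
↭⇒shuffle (prep x xs↭ys) with ↭⇒shuffle xs↭ys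
... | π , eq = Perm.lift₀ π , cong (x ∷_) eq
↭⇒shuffle (swap x y xs↭ys) with ↭⇒shuffle xs↭ys
... | π , eq = Perm.swap π , cong (λ u → x ∷ y ∷ u) eq
↭⇒shuffle (↭.trans {zs = zs} xs↭ys ys↭zs) with ↭⇒shuffle xs↭ys | ↭⇒shuffle ys↭zs
... | π , eq | ρ , eq′ = ρ Perm.∘ₚ π , trans (shuffle-∘ ρ π (fromList zs)) (trans (cong (shuffle π) eq′) eq)

map-shuffle : ∀ {b c} {B : Set b} {C : Set c} (f : B → C) (π : Permutation m n) (x : Vec B m) →
              Vec.map f (shuffle π x) ≡ shuffle π (Vec.map f x)
map-shuffle f π x = trans (sym (tabulate-∘ f _)) (tabulate-cong λ i → sym (lookup-map _ f x))

toVec : ∀ {b} {B : Set b} (xs : List B) → length xs ≡ n → ∃ λ (x : Vec B n) → toList x ≡ xs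
toVec xs refl = fromList xs , toList∘fromList xs

onTail : ∀ {b} {B : Set b} → (Vec B n → Vec B n) → Vec B (suc n) → Vec B (suc n)
onTail f (b ∷ x) = b ∷ f x

swapHeads : ∀ {b} {B : Set b} → Vec B (2 + n) → Vec B (2 + n)
swapHeads (b ∷ c ∷ x) = c ∷ b ∷ x

swapHeads-wire : ∀ {b} {B : Set b} (x : Vec B (2 + n)) → shuffle (Perm.swap Perm.id) x ≡ swapHeads x
swapHeads-wire (b ∷ c ∷ x) = cong (λ u → c ∷ b ∷ u) (tabulate∘lookup x)

-- Dickson's lemma for the componentwise order on ℕᵏ, and the lexicographic order.

infixl 6 _+ᵛ_
infix 4 _≤ᵛ_ _≺_

_+ᵛ_ : Vec ℕ k → Vec ℕ k → Vec ℕ k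
_+ᵛ_ = zipWith _+_

_≤ᵛ_ : Rel (Vec ℕ k) _
x ≤ᵛ y = ∃ λ z → y ≡ x +ᵛ z

_≺_ : Rel (Vec ℕ k) _
_≺_ = Lex-< _≡_ _<_

≺-wellFounded : WellFounded (_≺_ {k})
≺-wellFounded = Lex.<-wellFounded trans (λ { refl p → p }) <-wellFounded

≺-cmp : ∀ (x y : Vec ℕ k) → x ≺ y ⊎ x ≡ y ⊎ y ≺ x
≺-cmp x y with Lex.<-cmp sym ℕ.<-cmp x y
... | tri< x≺y _ _ = inj₁ x≺y
... | tri≈ _ x≋y _ = inj₂ (inj₁ (Pointwise-≡⇒≡ x≋y))
... | tri> _ _ y≺x = inj₂ (inj₂ y≺x)

≺-+ᵛ : ∀ {x y : Vec ℕ k} z → x ≺ y → x +ᵛ z ≺ y +ᵛ z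
≺-+ᵛ []      (Lex.base ())
≺-+ᵛ (c ∷ z) (this x<y _)    = this (ℕ.+-monoˡ-< c x<y) refl
≺-+ᵛ (c ∷ z) (next refl x≺y) = next refl (≺-+ᵛ z x≺y)

module _ {ℓ} (dec : (Q : Set ℓ) → Dec Q) where

  -- Dickson's lemma, by induction on the dimension: a basis of the union of
  -- all slices {x | (j , x) ∈ U} is attained below some J; the slices below J
  -- have bases of their own.
  dickson : ∀ k (U : Pred (Vec ℕ k) ℓ) → ∃ λ bs → All U bs × (∀ {x} → U x → Any (_≤ᵛ x) bs)
  dickson zero U with dec (U [])
  ... | yes U[] = [] ∷ [] , U[] ∷ [] , λ { {[]} _ → here ([] , refl) }
  ... | no ¬U[] = [] , [] , λ { {[]} U[] → contradiction U[] ¬U[] }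
  dickson (suc k) U with dickson k (λ x → ∃ λ j → U (j ∷ x))
  ... | bs , U-bs , bs-basis with attained U-bs
    where
    attained : ∀ {bs} → All (λ x → ∃ λ j → U (j ∷ x)) bs →
               ∃₂ λ J cs → All U cs × (∀ {j x} → J ≤ j → Any (_≤ᵛ x) bs → Any (_≤ᵛ (j ∷ x)) cs)
    attained [] = 0 , [] , [] , λ _ ()
    attained {b ∷ _} ((j , U-jb) ∷ U-bs) with attained U-bs
    ... | J , cs , U-cs , cs-basis = j ℕ.⊔ J , (j ∷ b) ∷ cs , U-jb ∷ U-cs , basis
      where
      basis : ∀ {i x} → j ℕ.⊔ J ≤ i → _ → Any (_≤ᵛ (i ∷ x)) ((j ∷ b) ∷ cs)
      basis {i} J≤i (here (z , refl)) = here (i ∸ j ∷ z ,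
        cong (_∷ _) (sym (ℕ.m+[n∸m]≡n (ℕ.≤-trans (ℕ.m≤m⊔n j J) J≤i))))
      basis J≤i (there b≤x) = there (cs-basis (ℕ.≤-trans (ℕ.m≤n⊔m j J) J≤i) b≤x)
  ... | J , cs , U-cs , cs-basis with slices J
    where
    slices : ∀ J → ∃ λ ds → All U ds × (∀ {j x} → j < J → U (j ∷ x) → Any (_≤ᵛ (j ∷ x)) ds)
    slices zero    = [] , [] , λ ()
    slices (suc J) with slices J | dickson k (λ x → U (J ∷ x))
    ... | ds , U-ds , ds-basis | es , U-es , es-basis =
      List.map (J ∷_) es List.++ ds , All.++⁺ (All.map⁺ U-es) U-ds , basis
      where
      basis : ∀ {j x} → j < suc J → U (j ∷ x) → Any (_≤ᵛ (j ∷ x)) (List.map (J ∷_) es List.++ ds)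
      basis j<1+J U-jx with ℕ.m≤n⇒m<n∨m≡n (ℕ.≤-pred j<1+J)
      ... | inj₁ j<J  = Any.++⁺ʳ _ (ds-basis j<J U-jx)
      ... | inj₂ refl = Any.++⁺ˡ (Any.map⁺ (Any.map
        (λ (z , eq) → 0 ∷ z , cong₂ _∷_ (sym (ℕ.+-identityʳ J)) eq) (es-basis U-jx)))
  ... | ds , U-ds , ds-basis = ds List.++ cs , All.++⁺ U-ds U-cs , basis
    where
    basis : ∀ {x} → U x → Any (_≤ᵛ x) (ds List.++ cs)
    basis {j ∷ x} U-jx with ℕ.<-≤-connex j J
    ... | inj₁ j<J = Any.++⁺ˡ (ds-basis j<J U-jx)
    ... | inj₂ J≤j = Any.++⁺ʳ ds (cs-basis J≤j (bs-basis (j , U-jx)))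

-- Parikh vectors and sorted words.

module _ {a} {A : Set a} where

  -- The sorted representative of the words with Parikh vector `cs` over the alphabet `as`.
  word : Vec A k → Vec ℕ k → List A
  word []       []       = []
  word (a ∷ as) (c ∷ cs) = List.replicate c a List.++ word as cs

  length-word : ∀ (a : A) (as : Vec A k) c cs → length (word (a ∷ as) (c ∷ cs)) ≡ c + length (word as cs)
  length-word a as c cs = trans (List.length-++ (List.replicate c a)) (cong (_+ _) (List.length-replicate c))

  word-increment : ∀ (as : Vec A k) cs i → lookup as i ∷ word as cs ↭ word as (cs [ i ]%= suc)
  word-increment (a ∷ as) (c ∷ cs) zero    = ↭-refl
  word-increment (a ∷ as) (c ∷ cs) (suc i) =
    ↭-trans (↭-sym (shift _ (List.replicate c a) _)) (++⁺ˡ (List.replicate c a) (word-increment as cs i))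

  word-zero : (as : Vec A k) → word as (Vec.replicate k 0) ≡ []
  word-zero []       = refl
  word-zero (a ∷ as) = word-zero as

  word-+ᵛ : ∀ (as : Vec A k) x y → word as (x +ᵛ y) ↭ word as x List.++ word as y
  word-+ᵛ []       []      []      = ↭-refl
  word-+ᵛ (a ∷ as) (c ∷ x) (d ∷ y) = ↭-trans
    (++⁺ (↭-reflexive (replicate-+ c d)) (word-+ᵛ as x y))
    (↭-trans (++-assoc (List.replicate c a) (List.replicate d a) _)
    (↭-trans (++⁺ˡ (List.replicate c a) (shifts (List.replicate d a) (word as x)))
             (↭-sym (++-assoc (List.replicate c a) (word as x) _))))
    where
    replicate-+ : ∀ c d → List.replicate (c + d) a ≡ List.replicate c a List.++ List.replicate d a
    replicate-+ zero    d = refl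
    replicate-+ (suc c) d = cong (a ∷_) (replicate-+ c d)

  -- If each of the k letters occurred at most four times, the length would be at most 4k. Five is
  -- the number of shared wires that `Step` asks for.
  pigeonhole : ∀ (as : Vec A k) cs → 4 * k < length (word as cs) →
               ∃₂ λ b rest → word as cs ↭ List.replicate 5 b List.++ rest
  pigeonhole [] [] ()
  pigeonhole {suc k} (a ∷ as) (c ∷ cs) 4k<c+n with 5 ℕ.≤? c
  ... | yes (s≤s (s≤s (s≤s (s≤s (s≤s z≤n))))) = a , _ , ↭-refl
  ... | no  5≰c with pigeonhole as cs 4k<n
    where
    4k<n : 4 * k < length (word as cs)
    4k<n = ℕ.+-cancelˡ-< 4 _ _ (ℕ.<-≤-trans
      (subst (_< length (word (a ∷ as) (c ∷ cs))) (ℕ.*-suc 4 k) 4k<c+n)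
      (ℕ.≤-trans (ℕ.≤-reflexive (length-word a as c cs)) (ℕ.+-monoˡ-≤ _ (ℕ.≤-pred (ℕ.≰⇒> 5≰c)))))
  ...   | b , rest , eq = b , List.replicate c a List.++ rest ,
    ↭-trans (++⁺ˡ (List.replicate c a) eq) (shifts (List.replicate c a) (List.replicate 5 b))

  zipped : ∀ (x y : List A) → length x ≡ length y →
           ∃ λ (zs : List (A × A)) → x ≡ List.map proj₁ zs × y ≡ List.map proj₂ zs
  zipped []      []      _ = [] , refl , refl
  zipped (b ∷ x) (c ∷ y) p with zipped x y (ℕ.suc-injective p)
  ... | zs , x≡ , y≡ = (b , c) ∷ zs , cong (b ∷_) x≡ , cong (c ∷_) y≡

  diagonal : List A → List (A × A)
  diagonal = List.map (λ b → b , b)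

  map-diagonal : ∀ (f : A × A → A) → (∀ b → f (b , b) ≡ b) → ∀ x → List.map f (diagonal x) ≡ x
  map-diagonal f f≡ x = trans (sym (List.map-∘ x)) (List.map-id-local (All.universal f≡ x))

-- Conservative maps that are even on every weight class.

module Conservation {a c ℓ} (dec : (Q : Set ℓ) → Dec Q) {A : Set a} (finite : Finite A)
                    (M : CommutativeMonoid c ℓ) (φ : List A → CommutativeMonoid.Carrier M)
                    (hom : IsMonoidHomomorphism (++-[]-rawMonoid A) (CommutativeMonoid.rawMonoid M) φ)
                    where

  private module M = CommutativeMonoid M
  open M using (_≈_)
  open IsMonoidHomomorphism hom using (homo; ε-homo)
  open Sum M using (sum; sum-permute; sum-cong-≋)

  infix 4 _∼_ _∼ᵛ_

  _∼_ : Rel (List A) ℓ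
  x ∼ y = φ x ≈ φ y

  ∼-∷ : ∀ b {x y} → x ∼ y → b ∷ x ∼ b ∷ y
  ∼-∷ b x∼y = M.trans (homo (b ∷ []) _) (M.trans (M.∙-congˡ x∼y) (M.sym (homo (b ∷ []) _)))

  ∼-++ : ∀ {u v x y} → u ∼ v → x ∼ y → u List.++ x ∼ v List.++ y
  ∼-++ u∼v x∼y = M.trans (homo _ _) (M.trans (M.∙-cong u∼v x∼y) (M.sym (homo _ _)))

  ∼-++-comm : ∀ x y → x List.++ y ∼ y List.++ x
  ∼-++-comm x y = M.trans (homo x y) (M.trans (M.comm _ _) (M.sym (homo y x)))

  _∼ᵛ_ : Rel (Vec A n) ℓ
  x ∼ᵛ y = toList x ∼ toList y

  _∼ᵛ?_ : Decidable (_∼ᵛ_ {n})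
  x ∼ᵛ? y = dec (x ∼ᵛ y)

  ∼ᵛ-isEquivalence : IsEquivalence (_∼ᵛ_ {n})
  ∼ᵛ-isEquivalence = record { refl = M.refl ; sym = M.sym ; trans = M.trans }

  _≟_ : DecidableEquality (Vec A n)
  _≟_ = ≡-dec (Finite⇒≟ finite)

  Class : Vec A n → Pred (Vec A n) ℓ
  Class = WeightClass M φ

  module _ {n : ℕ} where
    open Cycles (_≟_ {n}) public

  weight-sum : (x : Vec A n) → φ (toList x) ≈ sum (λ i → φ (lookup x i ∷ []))
  weight-sum []      = ε-homo
  weight-sum (b ∷ x) = M.trans (homo (b ∷ []) (toList x)) (M.∙-congˡ (weight-sum x))

  -- The weight of a word is the sum of the weights of its letters, and in a commutative monoid a
  -- sum does not depend on the order.
  shuffle-∼ᵛ : (π : Permutation m n) (x : Vec A m) → toList (shuffle π x) ∼ toList x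
  shuffle-∼ᵛ {m} {n} π x = M.trans (weight-sum (shuffle π x)) (M.trans
    (sum-cong-≋ {n} λ i → M.reflexive (cong (λ b → φ (b ∷ [])) (lookup∘tabulate (λ j → lookup x (π ⟨$⟩ˡ j)) i)))
    (M.trans (M.sym (sum-permute {n} {m} (λ i → φ (lookup x i ∷ [])) (Perm.flip π))) (M.sym (weight-sum x))))

  EvenConservative : Pred (Vec A n → Vec A n) (a ⊔ ℓ)
  EvenConservative f = (∀ x → f x ∼ᵛ x) × (∀ x → EvenOn _≟_ (Class x) f)

  product-++ : ∀ {x : Vec A n} ts us y →
    product _≟_ (Class x) (ts List.++ us) y ≡ product _≟_ (Class x) ts (product _≟_ (Class x) us y)
  product-++ []       us y = refl
  product-++ (t ∷ ts) us y = cong (transposeBy _≟_ _ t) (product-++ ts us y)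

  evenConservative-closed : IsClosed (EvenConservative {n})
  evenConservative-closed = record
    { id∈   = (λ _ → M.refl) , λ x → [] , 2 ∣0 , λ _ _ → refl
    ; ∘∈    = λ {f} {g} (f∼ , f-even) (g∼ , g-even) → (λ x → M.trans (f∼ (g x)) (g∼ x)) , λ x →
        let ts , 2∣ts , f≗ = f-even x ; us , 2∣us , g≗ = g-even x in
        ts List.++ us , subst (2 ∣_) (sym (List.length-++ ts)) (∣m∣n⇒∣m+n 2∣ts 2∣us) , λ y y∼x →
          trans (f≗ (g y) (M.trans (g∼ y) y∼x))
          (trans (cong (product _≟_ (Class x) ts) (g≗ y y∼x)) (sym (product-++ ts us y)))
    ; resp∈ = λ f≗g (f∼ , f-even) → (λ x → M.trans (M.reflexive (cong (φ ∘ toList) (sym (f≗g x)))) (f∼ x)) , λ x →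
        let ts , 2∣ts , f≗ = f-even x in ts , 2∣ts , λ y y∼x → trans (sym (f≗g y)) (f≗ y y∼x)
    }

  -- The map f is the composite of its restrictions to the weight classes, and each restriction is
  -- an even product of transpositions, hence a product of 3-cycles. With a suitable `S` this is an
  -- induction principle that reduces claims about such maps to 3-cycles.
  evenConservative⇒∈ : {S : Pred (Vec A n → Vec A n) s} → IsClosed S →
    (∀ {x y z} → x ∼ᵛ y → y ∼ᵛ z → Distinct x y z → S (cycle x y z)) →
    ∀ {f} → EvenConservative f → S f
  evenConservative⇒∈ {n} {S = S} S-closed cycle∈ {f} (f∼ , f-even) =
    restrict∈⇒∈ S-closed f∼ restricted (wordsOfLength (letters finite) n)
      λ y → Any.map (λ { refl → M.refl }) (∈-wordsOfLength (∈-letters finite) y)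
    where
    open Blocks (∼ᵛ-isEquivalence {n}) _∼ᵛ?_ id
    open Closed _≟_ S-closed
    open IsClosed S-closed

    restricted : ∀ x → S (restrict f x)
    restricted x with f-even x
    ... | ts , 2∣ts , f≗ = resp∈ agree (product∈ (Class x)
        (λ x∼ y∼ z∼ → cycle∈ (M.trans x∼ (M.sym y∼)) (M.trans y∼ (M.sym z∼))) ts 2∣ts)
      where
      agree : product _≟_ (Class x) ts ≗ restrict f x
      agree y with y ∼ᵛ? x
      ... | yes y∼x = sym (f≗ y y∼x)
      ... | no  y≁x = product-outside _≟_ (Class x) ts y≁x

  cycle-evenConservative : ∀ {x y z : Vec A n} → x ∼ᵛ y → y ∼ᵛ z → Distinct x y z →
                           EvenConservative (cycle x y z)
  cycle-evenConservative {n} {x} {y} {z} x∼y y∼z d = conservative , even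
    where
    open Distinct d

    conservative : ∀ u → cycle x y z u ∼ᵛ u
    conservative u with u ≟ x | u ≟ y | u ≟ z
    ... | yes refl | _ | _ = M.trans (M.reflexive (cong (φ ∘ toList) (cycle-first d))) (M.sym x∼y)
    ... | _ | yes refl | _ = M.trans (M.reflexive (cong (φ ∘ toList) (cycle-second d))) (M.sym y∼z)
    ... | _ | _ | yes refl = M.trans (M.reflexive (cong (φ ∘ toList) (cycle-third d))) (M.trans x∼y y∼z)
    ... | no u≢x | no u≢y | no u≢z = M.reflexive (cong (φ ∘ toList) (cycle-other u≢x u≢y u≢z))

    even : ∀ u → EvenOn _≟_ (Class u) (cycle x y z)
    even u with y ∼ᵛ? u
    ... | yes y∼u = record { left∈W = M.trans x∼y y∼u ; right∈W = y∼u ; distinct = 1≢2 }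
                  ∷ record { left∈W = y∼u ; right∈W = M.trans (M.sym y∼z) y∼u ; distinct = 2≢3 }
                  ∷ [] , ∣-refl , λ v _ → cycle≗transpositions x y z v
    ... | no  y≁u = [] , 2 ∣0 , λ v v∼u → cycle-other
      (λ { refl → y≁u (M.trans (M.sym x∼y) v∼u) }) (λ { refl → y≁u v∼u })
      (λ { refl → y≁u (M.trans y∼z v∼u) })

  -- The maps whose conjugate by h is even and conservative form a closed set. It contains the
  -- 3-cycles within weight classes, because h carries them to 3-cycles within the same weight
  -- classes.
  conjugate-evenConservative : {h h⁻¹ : Vec A n → Vec A n} → h ∘ h⁻¹ ≗ id → h⁻¹ ∘ h ≗ id →
    (∀ x → h x ∼ᵛ x) → ∀ {f} → EvenConservative f → EvenConservative (h ∘ f ∘ h⁻¹)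
  conjugate-evenConservative {n} {h} {h⁻¹} hh⁻¹ h⁻¹h h∼ = evenConservative⇒∈
    (record
      { id∈   = resp∈ (λ x → sym (hh⁻¹ x)) id∈
      ; ∘∈    = λ {f} {g} f∈ g∈ → resp∈ (λ x → cong (h ∘ f) (h⁻¹h (g (h⁻¹ x)))) (∘∈ f∈ g∈)
      ; resp∈ = λ f≗g → resp∈ (λ x → cong h (f≗g (h⁻¹ x)))
      })
    λ x∼y y∼z d → resp∈ (λ x → sym (cycle-conjugate d {h} {h⁻¹} hh⁻¹ h⁻¹h x))
      (cycle-evenConservative (h-cong x∼y) (h-cong y∼z) (Distinct-map d {h} {h⁻¹} h⁻¹h))
    where
    open IsClosed (evenConservative-closed {n})

    h-cong : ∀ {x y} → x ∼ᵛ y → h x ∼ᵛ h y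
    h-cong x∼y = M.trans (h∼ _) (M.trans x∼y (M.sym (h∼ _)))

  -- It suffices to extend a 3-cycle (x y z). The extension preserves the suffix v of every word,
  -- and on the block of words with suffix v it is the 3-cycle (xv yv zv).
  onPrefix-evenConservative : ∀ {f : Vec A m → Vec A m} → EvenConservative f →
                              EvenConservative (onPrefix {n = k} f)
  onPrefix-evenConservative {m} {k} = evenConservative⇒∈
    (record
      { id∈   = resp∈ (λ x → sym (take++drop≡id m x)) id∈
      ; ∘∈    = λ {f} {g} f∈ g∈ → resp∈ (λ x → onPrefix-++ f (g (take m x)) (drop m x)) (∘∈ f∈ g∈)
      ; resp∈ = λ f≗g → resp∈ (λ x → cong (_++ drop m x) (f≗g (take m x)))
      })
    cycle∈
    where
    open IsClosed (evenConservative-closed {m + k})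
    open Blocks (≡.isEquivalence {A = Vec A k}) _≟_ (drop m)

    cycle∈ : ∀ {x y z : Vec A m} → x ∼ᵛ y → y ∼ᵛ z → Distinct x y z → EvenConservative (onPrefix {n = k} (cycle x y z))
    cycle∈ {x} {y} {z} x∼y y∼z d = restrict∈⇒∈ evenConservative-closed {onPrefix (cycle x y z)}
      (λ u → proj₂ (take-drop-++ (cycle x y z (take m u)) (drop m u)))
      block (wordsOfLength (letters finite) k) (λ u → ∈-wordsOfLength (∈-letters finite) (drop m u))
      where
      block : ∀ v → EvenConservative (restrict (onPrefix (cycle x y z)) v)
      block v = resp∈ (λ u → sym (cycle-unique dᵛ at-x at-y at-z elsewhere u))
                  (cycle-evenConservative (++-cong x∼y) (++-cong y∼z) dᵛ)
        where
        ++-cong : ∀ {x y : Vec A m} → x ∼ᵛ y → x ++ v ∼ᵛ y ++ v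
        ++-cong {x} {y} x∼y = subst₂ (λ u u′ → φ u ≈ φ u′) (sym (toList-++ x v)) (sym (toList-++ y v)) (∼-++ {v = toList y} x∼y M.refl)

        ++-≢ : ∀ {x y : Vec A m} → x ≢ y → x ++ v ≢ y ++ v
        ++-≢ x≢y p = x≢y (++-injectiveˡ _ _ p)

        dᵛ : Distinct (x ++ v) (y ++ v) (z ++ v)
        dᵛ = distinct (++-≢ (Distinct.1≢2 d)) (++-≢ (Distinct.2≢3 d)) (++-≢ (Distinct.1≢3 d))

        inside : ∀ u {u′} → cycle x y z u ≡ u′ → restrict (onPrefix (cycle x y z)) v (u ++ v) ≡ u′ ++ v
        inside u p with drop m (u ++ v) ≟ v
        ... | yes _ = trans (onPrefix-++ (cycle x y z) u v) (cong (_++ v) p)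
        ... | no  q = contradiction (proj₂ (take-drop-++ u v)) q

        at-x = inside x (cycle-first d)
        at-y = inside y (cycle-second d)
        at-z = inside z (cycle-third d)

        elsewhere : ∀ u → u ≢ x ++ v → u ≢ y ++ v → u ≢ z ++ v → restrict (onPrefix (cycle x y z)) v u ≡ u
        elsewhere u u≢x u≢y u≢z with drop m u ≟ v
        ... | no  _    = refl
        ... | yes refl = trans (cong (_++ drop m u) (cycle-other (apart u≢x) (apart u≢y) (apart u≢z))) (take++drop≡id m u)
          where
          apart : ∀ {x} → u ≢ x ++ drop m u → take m u ≢ x
          apart u≢x p = u≢x (trans (sym (take++drop≡id m u)) (cong (_++ drop m u) p))

  module _ {p} {P : Pred (Gate A) p} where

    revital⊆ECons : (∀ {g} → P g → ECons M φ (Finite⇒≟ finite) g) →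
                    ∀ {g} → ⌈ P ⌉ g → ECons M φ (Finite⇒≟ finite) g
    revital⊆ECons P⊆ id₁ = IsClosed.id∈ evenConservative-closed
    revital⊆ECons P⊆ (gen g∈P) = P⊆ g∈P
    revital⊆ECons P⊆ (comp f∈ g∈) = IsClosed.∘∈ evenConservative-closed (revital⊆ECons P⊆ f∈) (revital⊆ECons P⊆ g∈)
    revital⊆ECons P⊆ (extend k α f∈) = conjugate-evenConservative
      {h = apply (wire α)} {Inverse.from (wire α)}
      (Inverse.strictlyInverseˡ (wire α)) (Inverse.strictlyInverseʳ (wire α)) (λ x → shuffle-∼ᵛ α x)
      (onPrefix-evenConservative (revital⊆ECons P⊆ f∈))
    revital⊆ECons P⊆ (resp {f} {g} (refl , f≗g) f∈) = IsClosed.resp∈ evenConservative-closed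
      (λ x → trans (sym (cast-is-id refl _)) (trans (f≗g x) (cong (apply (bij g)) (cast-is-id refl x))))
      (revital⊆ECons P⊆ f∈)

  -- Links between words that share a letter on five wires.

  ↭⇒∼ : ∀ {xs ys} → xs ↭ ys → xs ∼ ys
  ↭⇒∼ ↭.refl                  = M.refl
  ↭⇒∼ (prep x xs↭ys)          = ∼-∷ x (↭⇒∼ xs↭ys)
  ↭⇒∼ (swap x y xs↭ys)        = ∼-++ (∼-++-comm (x ∷ []) (y ∷ [])) (↭⇒∼ xs↭ys)
  ↭⇒∼ (↭.trans xs↭ys ys↭zs)   = M.trans (↭⇒∼ xs↭ys) (↭⇒∼ ys↭zs)

  -- In a cancellative M the condition on rest would say xs ∼ ys; in general it
  -- is stronger, and it is needed in order to drop a shared wire.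
  record Step (xs ys : List A) : Set (a ⊔ ℓ) where
    constructor step
    field
      {columns} : List (A × A)
      row₁      : xs ≡ List.map proj₁ columns
      row₂      : ys ≡ List.map proj₂ columns
      b         : A
      {rest}    : List (A × A)
      shared    : columns ↭ List.replicate 5 (b , b) List.++ rest
      rest∼     : List.map proj₁ rest ∼ List.map proj₂ rest

  module _ {p} (P : Pred (Gate A) p) where

    AllCyclesRealised : ∀ n → .{{NonZero n}} → Set _
    AllCyclesRealised n = ∀ {x y z : Vec A n} → x ∼ᵛ y → y ∼ᵛ z → Distinct x y z → Realised {P = P} (cycle x y z)

    module _ {m} (cycles : AllCyclesRealised (suc m)) where

      -- The commutator of a cycle that ignores the first wire with one that
      -- ignores the second; the only word moved by both is b ∷ b ∷ v.
      prefixed-cycle : ∀ b {v x y x′ y′ : Vec A m} → x ∼ᵛ v → y ∼ᵛ v → x′ ∼ᵛ v → y′ ∼ᵛ v →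
        Distinct v x y → Distinct v x′ y′ → x ≢ x′ → x ≢ y′ → y ≢ x′ → y ≢ y′ →
        Distinct (b ∷ b ∷ v) (b ∷ b ∷ x) (b ∷ b ∷ x′) ×
        Realised {P = P} (cycle (b ∷ b ∷ v) (b ∷ b ∷ x) (b ∷ b ∷ x′))
      prefixed-cycle b {v} {x} {y} {x′} {y′} x∼v y∼v x′∼v y′∼v vxy vx′y′ x≢x′ x≢y′ y≢x′ y≢y′ =
        transport (proj₁ commutator) , resp∈ agree (∘∈ f∈ (∘∈ g∈ (∘∈ f⁻¹∈ g⁻¹∈)))
        where
        open IsClosed (realised-closed {P = P} {n = 2 + m})

        ∷-distinct : ∀ {x y} → Distinct v x y → Distinct (b ∷ v) (b ∷ x) (b ∷ y)
        ∷-distinct (distinct p q r) = distinct (p ∘ ∷-injectiveʳ) (q ∘ ∷-injectiveʳ) (r ∘ ∷-injectiveʳ)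

        d = ∷-distinct vxy
        d′ = ∷-distinct vx′y′

        κ κ⁻¹ κ′ κ′⁻¹ : Vec A (suc m) → Vec A (suc m)
        κ    = cycle (b ∷ v) (b ∷ x) (b ∷ y)
        κ⁻¹  = cycle (b ∷ v) (b ∷ y) (b ∷ x)
        κ′   = cycle (b ∷ v) (b ∷ x′) (b ∷ y′)
        κ′⁻¹ = cycle (b ∷ v) (b ∷ y′) (b ∷ x′)

        κ∈ : ∀ {x y} → x ∼ᵛ v → y ∼ᵛ v → Distinct (b ∷ v) (b ∷ x) (b ∷ y) →
             Realised {P = P} (cycle (b ∷ v) (b ∷ x) (b ∷ y))
        κ∈ x∼v y∼v = cycles (∼-∷ b (M.sym x∼v)) (∼-∷ b (M.trans x∼v (M.sym y∼v)))

        skipSecond : (Vec A (suc m) → Vec A (suc m)) → Vec A (2 + m) → Vec A (2 + m)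
        skipSecond h = swapHeads ∘ onTail h ∘ swapHeads

        onTail∈ : ∀ {h} → Realised {P = P} h → Realised {P = P} (onTail h)
        onTail∈ = realised-tail λ _ _ → refl

        skipSecond∈ : ∀ {h} → Realised {P = P} h → Realised {P = P} (skipSecond h)
        skipSecond∈ {h} h∈ = resp∈
          (λ u → trans (swapHeads-wire _) (cong (swapHeads ∘ onTail h) (swapHeads-wire u)))
          (realised-rewire (Perm.swap Perm.id) (onTail∈ h∈))

        onTail-inverse : ∀ {h h⁻¹ : Vec A (suc m) → Vec A (suc m)} → h ∘ h⁻¹ ≗ id → onTail h ∘ onTail h⁻¹ ≗ id
        onTail-inverse hh⁻¹ (c ∷ u) = cong (c ∷_) (hh⁻¹ u)

        swapHeads-involutive : ∀ u → swapHeads {n = m} {B = A} (swapHeads u) ≡ u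
        swapHeads-involutive (_ ∷ _ ∷ _) = refl

        skipSecond-inverse : ∀ {h h⁻¹ : Vec A (suc m) → Vec A (suc m)} → h ∘ h⁻¹ ≗ id →
                             skipSecond h ∘ skipSecond h⁻¹ ≗ id
        skipSecond-inverse {h} {h⁻¹} hh⁻¹ u = trans
          (cong (swapHeads ∘ onTail h) (swapHeads-involutive _))
          (trans (cong swapHeads (onTail-inverse hh⁻¹ (swapHeads u))) (swapHeads-involutive u))

        f = onTail κ
        g = skipSecond κ′

        f∈ = onTail∈ (κ∈ x∼v y∼v d)
        f⁻¹∈ = onTail∈ (κ∈ y∼v x∼v (reflect d))
        g∈ = skipSecond∈ (κ∈ x′∼v y′∼v d′)
        g⁻¹∈ = skipSecond∈ (κ∈ y′∼v x′∼v (reflect d′))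

        start : Vec A (2 + m)
        start = b ∷ b ∷ v

        f-start : f start ≡ b ∷ b ∷ x
        f-start = cong (b ∷_) (cycle-first d)

        g-start : g start ≡ b ∷ b ∷ x′
        g-start = cong (swapHeads ∘ (b ∷_)) (cycle-first d′)

        moved? : ∀ {x y z : Vec A (suc m)} u → cycle x y z u ≡ u ⊎ u ≡ x ⊎ u ≡ y ⊎ u ≡ z
        moved? {x} {y} {z} u with u ≟ x | u ≟ y | u ≟ z
        ... | yes u≡x | _       | _       = inj₂ (inj₁ u≡x)
        ... | _       | yes u≡y | _       = inj₂ (inj₂ (inj₁ u≡y))
        ... | _       | _       | yes u≡z = inj₂ (inj₂ (inj₂ u≡z))
        ... | no u≢x  | no u≢y  | no u≢z  = inj₁ (cycle-other u≢x u≢y u≢z)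

        -- A word b₀b₁u moved by `f` has b₁u among bv, bx, by; if `g` moves it, b₀u is among bv,
        -- bx′, by′. If both hold, then u = v and b₀ = b₁ = b.
        meet : ∀ u → f u ≡ u ⊎ g u ≡ u ⊎ u ≡ start
        meet (b₀ ∷ b₁ ∷ u) with moved? {b ∷ v} {b ∷ x} {b ∷ y} (b₁ ∷ u) | moved? {b ∷ v} {b ∷ x′} {b ∷ y′} (b₀ ∷ u)
        ... | inj₁ fixed | _          = inj₁ (cong (b₀ ∷_) fixed)
        ... | _          | inj₁ fixed = inj₂ (inj₁ (cong (swapHeads ∘ (b₁ ∷_)) fixed))
        ... | inj₂ (inj₁ refl) | inj₂ (inj₁ refl) = inj₂ (inj₂ refl)
        ... | inj₂ (inj₁ refl) | inj₂ (inj₂ (inj₁ refl)) = contradiction refl (Distinct.1≢2 vx′y′)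
        ... | inj₂ (inj₁ refl) | inj₂ (inj₂ (inj₂ refl)) = contradiction refl (Distinct.1≢3 vx′y′)
        ... | inj₂ (inj₂ (inj₁ refl)) | inj₂ (inj₁ refl) = contradiction refl (Distinct.1≢2 vxy)
        ... | inj₂ (inj₂ (inj₁ refl)) | inj₂ (inj₂ (inj₁ refl)) = contradiction refl x≢x′
        ... | inj₂ (inj₂ (inj₁ refl)) | inj₂ (inj₂ (inj₂ refl)) = contradiction refl x≢y′
        ... | inj₂ (inj₂ (inj₂ refl)) | inj₂ (inj₁ refl) = contradiction refl (Distinct.1≢3 vxy)
        ... | inj₂ (inj₂ (inj₂ refl)) | inj₂ (inj₂ (inj₁ refl)) = contradiction refl y≢x′
        ... | inj₂ (inj₂ (inj₂ refl)) | inj₂ (inj₂ (inj₂ refl)) = contradiction refl y≢y′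

        commutator = commutator-cycle {f = f} {onTail κ⁻¹} {g} {skipSecond κ′⁻¹}
          (onTail-inverse (cycle-inverse d)) (onTail-inverse (cycle-inverse (reflect d)))
          (skipSecond-inverse (cycle-inverse d′)) (skipSecond-inverse (cycle-inverse (reflect d′)))
          {start}
          (λ p → Distinct.1≢2 d (sym (∷-injectiveʳ (trans (sym f-start) p))))
          (λ p → Distinct.1≢2 d′ (sym (∷-injectiveʳ (trans (sym g-start) p))))
          meet

        transport : Distinct start (f start) (g start) → Distinct start (b ∷ b ∷ x) (b ∷ b ∷ x′)
        transport = subst₂ (Distinct start) f-start g-start

        agree : f ∘ g ∘ onTail κ⁻¹ ∘ skipSecond κ′⁻¹ ≗ cycle start (b ∷ b ∷ x) (b ∷ b ∷ x′)
        agree u = trans (proj₂ commutator u) (cong₂ (λ w w′ → cycle start w w′ u) f-start g-start)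

    -- The weight class that holds the third point is given by the representative x. Equality of
    -- weights is carried along so that the representative can be changed under symmetry and
    -- transitivity.
    Joined : .{{NonZero n}} → Rel (Vec A n) (a ⊔ p ⊔ ℓ)
    Joined {n} x y = x ∼ᵛ y × Linked (_∼ᵛ x) x y
      where open Closed (_≟_ {n}) (realised-closed {P = P})

    module _ {n} .{{_ : NonZero n}} where
      open Closed (_≟_ {n}) (realised-closed {P = P})

      Linked-∼ : ∀ {x y u v : Vec A n} → u ∼ᵛ v → Linked (_∼ᵛ u) x y → Linked (_∼ᵛ v) x y
      Linked-∼ u∼v (inj₁ x≡y)                    = inj₁ x≡y
      Linked-∼ u∼v (inj₂ (z , z∼u , d , cycle∈)) = inj₂ (z , M.trans z∼u u∼v , d , cycle∈)

      Joined-refl : ∀ {x y : Vec A n} → x ≡ y → Joined x y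
      Joined-refl refl = M.refl , inj₁ refl

      Joined-sym : ∀ {x y : Vec A n} → Joined x y → Joined y x
      Joined-sym {x} {y} (x∼y , xy) = M.sym x∼y , Linked-∼ {u = x} {y} x∼y (Linked-sym _ xy)

      Joined-trans : ∀ {x y z : Vec A n} → Joined x y → Joined y z → Joined x z
      Joined-trans {x} {y} {z} (x∼y , xy) (y∼z , yz) = M.trans x∼y y∼z ,
        Linked-trans (_∼ᵛ x) (M.sym x∼y) (M.sym (M.trans x∼y y∼z)) xy (Linked-∼ {u = y} {x} (M.sym x∼y) yz)

      joined⇒cycles : (∀ {x y : Vec A n} → x ∼ᵛ y → Joined x y) → AllCyclesRealised n
      joined⇒cycles joined {x} x∼y y∼z = linked⇒cycle∈ (_∼ᵛ x)
        (λ {u} u∼x v∼x → Linked-∼ {u = u} {x} u∼x (proj₂ (joined (M.trans u∼x (M.sym v∼x)))))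
        M.refl (M.sym x∼y) (M.sym (M.trans x∼y y∼z))

      Joined-wire : (α : Permutation′ n) {x y : Vec A n} → Joined x y → Joined (shuffle α x) (shuffle α y)
      Joined-wire α {x} {y} (x∼y , xy) =
        M.trans (shuffle-∼ᵛ α x) (M.trans x∼y (M.sym (shuffle-∼ᵛ α y))) , shuffled xy
        where
        h = apply (wire α)
        h⁻¹ = Inverse.from (wire α)

        shuffled : Linked (_∼ᵛ x) x y → Linked (_∼ᵛ shuffle α x) (shuffle α x) (shuffle α y)
        shuffled (inj₁ x≡y) = inj₁ (cong (shuffle α) x≡y)
        shuffled (inj₂ (z , z∼x , d , cycle∈)) = inj₂ (shuffle α z ,
          M.trans (shuffle-∼ᵛ α z) (M.trans z∼x (M.sym (shuffle-∼ᵛ α x))) ,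
          Distinct-map d {h} {h⁻¹} (Inverse.strictlyInverseʳ (wire α)) ,
          IsClosed.resp∈ realised-closed
            (cycle-conjugate d {h} {h⁻¹} (Inverse.strictlyInverseˡ (wire α)) (Inverse.strictlyInverseʳ (wire α)))
            (realised-rewire α cycle∈))

    Joined-shuffle : .{{_ : NonZero m}} .{{_ : NonZero n}} (π : Permutation m n) {x y : Vec A m} →
                     Joined x y → Joined (shuffle π x) (shuffle π y)
    Joined-shuffle {zero}  π {[]} {[]} _ = Joined-refl refl
    Joined-shuffle {suc _} π joined with ↔⇒≡ π
    ... | refl = Joined-wire π joined

    module _ {m} (cycles : AllCyclesRealised (5 + m)) where

      -- Two of the five b's are the wires that the commutator adds. The other three are places to
      -- which d can be moved, which gives the auxiliary words `x₁`, `x₂`, `x₃`. Each of these has d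
      -- among its first three letters, while `x` and `y` begin with bbb; so d ≠ b keeps all five
      -- words apart.
      joined-base : ∀ b {d e} {u v : Vec A m} → d ≢ b → d ∷ u ∼ᵛ e ∷ v →
        Joined (b ∷ b ∷ b ∷ b ∷ b ∷ d ∷ u) (b ∷ b ∷ b ∷ b ∷ b ∷ e ∷ v)
      joined-base b {d} {e} {u} {v} d≢b du∼ev with (d ∷ u) ≟ (e ∷ v)
      ... | yes du≡ev = Joined-refl (cong (λ w → b ∷ b ∷ b ∷ b ∷ b ∷ w) du≡ev)
      ... | no  du≢ev = bbx∼bby , inj₂ (b ∷ b ∷ x₂ , ∼-∷ b (∼-∷ b x₂∼x) , proj₁ spec , proj₂ spec)
        where
        x y x₁ x₂ x₃ : Vec A (4 + m)
        x  = b ∷ b ∷ b ∷ d ∷ u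
        y  = b ∷ b ∷ b ∷ e ∷ v
        x₁ = d ∷ b ∷ b ∷ b ∷ u
        x₂ = b ∷ d ∷ b ∷ b ∷ u
        x₃ = b ∷ b ∷ d ∷ b ∷ u

        x₁∼x : x₁ ∼ᵛ x
        x₁∼x = ↭⇒∼ (↭-sym (shift d (b ∷ b ∷ b ∷ []) (toList u)))

        x₂∼x : x₂ ∼ᵛ x
        x₂∼x = ↭⇒∼ (prep b (↭-sym (shift d (b ∷ b ∷ []) (toList u))))

        x₃∼x : x₃ ∼ᵛ x
        x₃∼x = ↭⇒∼ (prep b (prep b (swap d b ↭-refl)))

        y∼x : y ∼ᵛ x
        y∼x = ∼-∷ b (∼-∷ b (∼-∷ b (M.sym du∼ev)))

        bbx∼bby = ∼-∷ b (∼-∷ b (M.sym y∼x))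

        spec = prefixed-cycle cycles b y∼x x₁∼x x₂∼x x₃∼x
          (distinct (λ { refl → du≢ev refl }) (λ { refl → d≢b refl }) (λ { refl → d≢b refl }))
          (distinct (λ { refl → d≢b refl }) (λ { refl → d≢b refl }) (λ { refl → d≢b refl }))
          (λ { refl → d≢b refl }) (λ { refl → d≢b refl }) (λ { refl → d≢b refl }) (λ { refl → d≢b refl })

    map-fromList : ∀ {b c} {B : Set b} {C : Set c} (f : B → C) (xs : List B) (x : Vec C (length xs)) →
                   toList x ≡ List.map f xs → x ≡ Vec.map f (fromList xs)
    map-fromList f xs x eq = trans (sym (cast-is-id refl x)) (toList-injective refl x _
      (trans eq (sym (trans (toList-map f (fromList xs)) (cong (List.map f) (toList∘fromList xs))))))

    module _ (b : A) where

      -- Such a column provides the letter other than b that `joined-base` needs, possibly after the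
      -- rows are exchanged. If there is none, the rows coincide.
      OffDiagonal : Pred (A × A) a
      OffDiagonal (d , e) = d ≢ b ⊎ e ≢ b

      rows-equal : ∀ zs → ¬ Any OffDiagonal zs → List.map proj₁ zs ≡ List.map proj₂ zs
      rows-equal [] _ = refl
      rows-equal ((d , e) ∷ zs) ¬off with Finite⇒≟ finite d b | Finite⇒≟ finite e b
      ... | yes refl | yes refl = cong (d ∷_) (rows-equal zs (¬off ∘ there))
      ... | no  d≢b  | _        = contradiction (here (inj₁ d≢b)) ¬off
      ... | _        | no  e≢b  = contradiction (here (inj₂ e≢b)) ¬off

      offDiagonal-replicate : ∀ k {ws} → Any OffDiagonal (List.replicate k (b , b) List.++ ws) → Any OffDiagonal ws
      offDiagonal-replicate zero    off                = off
      offDiagonal-replicate (suc k) (here (inj₁ b≢b)) = contradiction refl b≢b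
      offDiagonal-replicate (suc k) (here (inj₂ b≢b)) = contradiction refl b≢b
      offDiagonal-replicate (suc k) (there off)        = offDiagonal-replicate k off

      extract : ∀ {ws} → Any OffDiagonal ws → ∃ λ z → ∃ λ vs → OffDiagonal z × ws ↭ z ∷ vs
      extract {z ∷ vs} (here off)  = z , vs , off , ↭-refl
      extract {y ∷ ws} (there off) with extract off
      ... | z , vs , off-z , ws↭ = z , y ∷ vs , off-z , ↭-trans (prep y ws↭) (swap y z ↭-refl)

    -- A wire permutation brings five columns (b , b) to the front, followed by a column that is not
    -- (b , b), and `joined-base` applies there. The arity below n is given by an equation because n
    -- becomes the number of columns only within the proof.
    step⇒joined : ∀ {n} .{{_ : NonZero n}} → (∀ {n′} .{{_ : NonZero n′}} → suc n′ ≡ n → AllCyclesRealised n′) →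
                  ∀ {x y : Vec A n} → Step (toList x) (toList y) → Joined x y
    step⇒joined cycles {x} {y} (step {zs} row₁ row₂ b {ws} shared ws∼)
      with trans (sym (length-toList x)) (trans (cong length row₁) (List.length-map proj₁ zs))
    ... | refl with Any.any? (λ (d , e) → ¬? (Finite⇒≟ finite d b) ⊎-dec ¬? (Finite⇒≟ finite e b)) zs
    ...   | no ¬off = Joined-refl (trans (sym (cast-is-id refl x))
                        (toList-injective refl x y (trans row₁ (trans (rows-equal b zs ¬off) (sym row₂)))))
    ...   | yes off with extract b (offDiagonal-replicate b 5 (Any-resp-↭ shared off))
    ...     | (d , e) , vs , off′ , ws↭ with ↭-trans shared (++⁺ˡ (List.replicate 5 (b , b)) ws↭)
    ...       | shared′ with ↭⇒shuffle shared′
    ...         | π , π-eq = subst₂ Joined (sym (row proj₁ row₁)) (sym (row proj₂ row₂))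
                               (Joined-shuffle π (base off′))
      where
      row : (proj : A × A → A) {x : Vec A (length zs)} → toList x ≡ List.map proj zs →
            x ≡ shuffle π (Vec.map proj (fromList (List.replicate 5 (b , b) List.++ (d , e) ∷ vs)))
      row proj {x} eq = trans (map-fromList proj zs x eq)
        (trans (cong (Vec.map proj) (sym π-eq)) (map-shuffle proj π (fromList (List.replicate 5 (b , b) List.++ (d , e) ∷ vs))))

      cycles′ : AllCyclesRealised (5 + length vs)
      cycles′ = cycles (sym (↭-length shared′))

      u = Vec.map proj₁ (fromList vs)
      v = Vec.map proj₂ (fromList vs)

      toList-row : (proj : A × A → A) → toList (Vec.map proj (fromList vs)) ≡ List.map proj vs
      toList-row proj = trans (toList-map proj (fromList vs)) (cong (List.map proj) (toList∘fromList vs))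

      du∼ev : d ∷ u ∼ᵛ e ∷ v
      du∼ev = M.trans (M.reflexive (cong (λ w → φ (d ∷ w)) (toList-row proj₁)))
        (M.trans (M.trans (↭⇒∼ (↭-sym (map⁺ proj₁ ws↭))) (M.trans ws∼ (↭⇒∼ (map⁺ proj₂ ws↭))))
                 (M.reflexive (cong (λ w → φ (e ∷ w)) (sym (toList-row proj₂)))))

      base : OffDiagonal b (d , e) → Joined (b ∷ b ∷ b ∷ b ∷ b ∷ d ∷ u) (b ∷ b ∷ b ∷ b ∷ b ∷ e ∷ v)
      base (inj₁ d≢b) = joined-base cycles′ b d≢b du∼ev
      base (inj₂ e≢b) = Joined-sym (joined-base cycles′ b e≢b (M.sym du∼ev))

    module _ {n} .{{_ : NonZero n}} (cycles : ∀ {n′} .{{_ : NonZero n′}} → suc n′ ≡ n → AllCyclesRealised n′) where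

      steps⇒joined : ∀ {xs ys} → EqClosure Step xs ys → (x y : Vec A n) → toList x ≡ xs → toList y ≡ ys → Joined x y
      steps⇒joined ε x y refl ys≡ = Joined-refl (trans (sym (cast-is-id refl x)) (toList-injective refl x y (sym ys≡)))
      steps⇒joined (_◅_ {j = zs} s ss) x y refl ys≡ with toVec {n = n} zs (trans (sym (same-length s)) (length-toList x))
        where
        step-length : ∀ {xs ys} → Step xs ys → length xs ≡ length ys
        step-length (step {zs} refl refl _ _ _) = trans (List.length-map proj₁ zs) (sym (List.length-map proj₂ zs))

        same-length : ∀ {xs ys} → SymClosure Step xs ys → length xs ≡ length ys
        same-length (fwd s) = step-length s
        same-length (bwd s) = sym (step-length s)
      ... | z , refl = Joined-trans (joined s) (steps⇒joined ss z y refl ys≡)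
        where
        joined : SymClosure Step (toList x) (toList z) → Joined x z
        joined (fwd s) = step⇒joined cycles s
        joined (bwd s) = Joined-sym (step⇒joined cycles s)

  -- Connectedness of the weight classes of long words.

  private
    κ : ℕ
    κ = proj₁ finite

    as : Vec A κ
    as = Vec.tabulate (Inverse.from (proj₂ finite))

    ∥_∥ : Vec ℕ κ → ℕ
    ∥ x ∥ = length (word as x)

  parikh : ∀ xs → ∃ λ x → xs ↭ word as x
  parikh []       = Vec.replicate κ 0 , ↭-reflexive (sym (word-zero as))
  parikh (b ∷ xs) with parikh xs
  ... | x , xs↭ = x [ i ]%= suc , ↭-trans (prep b xs↭)
    (subst (λ d → d ∷ word as x ↭ word as (x [ i ]%= suc)) eq (word-increment as x i))
    where
    open Inverse (proj₂ finite)
    i = to b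
    eq : lookup as i ≡ b
    eq = trans (lookup∘tabulate from i) (strictlyInverseʳ b)

  frequent : ∀ xs → 4 * κ < length xs → ∃₂ λ b rest → xs ↭ List.replicate 5 b List.++ rest
  frequent xs 4κ< with parikh xs
  ... | x , xs↭ with pigeonhole as x (subst (4 * κ <_) (↭-length xs↭) 4κ<)
  ...   | b , rest , eq = b , rest , ↭-trans xs↭ eq

  infix 4 _≈*_
  _≈*_ : Rel (List A) _
  _≈*_ = EqClosure Step

  -- Outside the two places some letter d occurs five times and gives the shared columns (d , d).
  -- The columns (b , c) and (c , b) go into `rest`, whose rows have equal weight by commutativity.
  transpose-step : ∀ ps b c xs → 4 * κ < length (ps List.++ xs) → Step (ps List.++ b ∷ c ∷ xs) (ps List.++ c ∷ b ∷ xs)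
  transpose-step ps b c xs 4κ< with frequent (ps List.++ xs) 4κ<
  ... | d , rest , eq = step {columns = diagonal ps List.++ (b , c) ∷ (c , b) ∷ diagonal xs}
    (row proj₁ (λ _ → refl)) (row proj₂ (λ _ → refl)) d {rest = (b , c) ∷ (c , b) ∷ diagonal rest} shared
    (∼-++ (∼-++-comm (b ∷ []) (c ∷ [])) (M.reflexive (cong φ (trans (map-diagonal proj₁ (λ _ → refl) rest) (sym (map-diagonal proj₂ (λ _ → refl) rest))))))
    where
    row : (f : A × A → A) → (∀ b → f (b , b) ≡ b) →
      ps List.++ f (b , c) ∷ f (c , b) ∷ xs ≡ List.map f (diagonal ps List.++ (b , c) ∷ (c , b) ∷ diagonal xs)
    row f f≡ = sym (trans (List.map-++ f (diagonal ps) _)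
      (cong₂ (λ u v → u List.++ f (b , c) ∷ f (c , b) ∷ v) (map-diagonal f f≡ ps) (map-diagonal f f≡ xs)))

    shared : diagonal ps List.++ (b , c) ∷ (c , b) ∷ diagonal xs ↭
             List.replicate 5 (d , d) List.++ (b , c) ∷ (c , b) ∷ diagonal rest
    shared = ↭-trans (shifts (diagonal ps) ((b , c) ∷ (c , b) ∷ []))
      (↭-trans (prep _ (prep _ (↭-trans (↭-reflexive (sym (List.map-++ _ ps xs))) (map⁺ _ eq))))
               (shifts ((b , c) ∷ (c , b) ∷ []) (List.replicate 5 (d , d))))

  -- The prefix `ps` keeps the whole word in view, since the letter that occurs five times may occur
  -- in the part already passed. The summand 2 accounts for the pair being transposed, besides which
  -- more than 4κ letters must remain.
  ↭⇒≈* : ∀ ps {xs ys} → xs ↭ ys → 2 + 4 * κ < length (ps List.++ xs) → ps List.++ xs ≈* ps List.++ ys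
  ↭⇒≈* ps ↭.refl _ = ε
  ↭⇒≈* ps (prep {xs} {ys} b xs↭ys) long = subst₂ _≈*_ (List.++-assoc ps (b ∷ []) xs) (List.++-assoc ps (b ∷ []) ys)
    (↭⇒≈* (ps List.++ b ∷ []) xs↭ys (subst (λ u → 2 + 4 * κ < length u) (sym (List.++-assoc ps (b ∷ []) xs)) long))
  ↭⇒≈* ps (swap {xs} {ys} b c xs↭ys) long =
    EqClosure.return (transpose-step ps b c xs (ℕ.+-cancelˡ-< 2 _ _ (subst (2 + 4 * κ <_) (↭-length (shifts ps (b ∷ c ∷ []))) long)))
    ◅◅ subst₂ _≈*_ (List.++-assoc ps (c ∷ b ∷ []) xs) (List.++-assoc ps (c ∷ b ∷ []) ys)
      (↭⇒≈* (ps List.++ c ∷ b ∷ []) xs↭ys (subst (2 + 4 * κ <_)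
        (trans (↭-length (++⁺ˡ ps (swap b c ↭-refl))) (cong length (sym (List.++-assoc ps (c ∷ b ∷ []) xs)))) long))
  ↭⇒≈* ps (↭.trans xs↭ys ys↭zs) long =
    ↭⇒≈* ps xs↭ys long ◅◅ ↭⇒≈* ps ys↭zs (subst (2 + 4 * κ <_) (↭-length (++⁺ˡ ps xs↭ys)) long)

  -- Failure to be the lexicographic minimum for the given length and weight. For a basis vector b
  -- the witness is the smaller partner b′.
  Reducible : Pred (Vec ℕ κ) ℓ
  Reducible x = ∃ λ y → y ≺ x × ∥ y ∥ ≡ ∥ x ∥ × word as y ∼ word as x

  private
    basis = dickson dec κ Reducible

    bound : List (Vec ℕ κ) → ℕ
    bound = List.foldr (λ b n → ∥ b ∥ ℕ.⊔ n) 0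

    ≤-bound : ∀ {x} {bs} → Any (_≤ᵛ x) bs → All Reducible bs →
              ∃₂ λ b z → Reducible b × ∥ b ∥ ≤ bound bs × x ≡ b +ᵛ z
    ≤-bound (here (z , eq)) (red ∷ _) = _ , z , red , ℕ.m≤m⊔n _ _ , eq
    ≤-bound (there b≤x) (_ ∷ reds) with ≤-bound b≤x reds
    ... | b , z , red , b≤ , eq = b , z , red , ℕ.≤-trans b≤ (ℕ.m≤n⊔m _ _) , eq

  -- If b + z has at least this size and b is in the basis, then z has at least 3 + 4κ letters:
  -- enough for five equal letters in z, and for `↭⇒≈*` on the whole word.
  threshold : ℕ
  threshold = bound (proj₁ basis) + (3 + 4 * κ)

  long : ∀ {n} → threshold ≤ n → 2 + 4 * κ < n
  long = ℕ.≤-trans (ℕ.m≤n+m _ (bound (proj₁ basis)))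

  -- Write x = b + z with b in the basis, and take five copies of a letter d from z. After sorting
  -- these to the front, one step replaces b by b′ while the rest of z stays. Its weight condition
  -- follows from that of b and b′ by adding the rest of z, without cancellation.
  reduce : ∀ {x} → Reducible x → threshold ≤ ∥ x ∥ →
           ∃ λ y → y ≺ x × ∥ y ∥ ≡ ∥ x ∥ × word as y ∼ word as x × word as x ≈* word as y
  reduce {x} red t≤ with ≤-bound (proj₂ (proj₂ basis) red) (proj₁ (proj₂ basis))
  ... | b , z , (b′ , b′≺b , size≡ , b′∼b) , b≤ , refl with frequent (word as z) 4κ<
    where
    4κ< : 4 * κ < ∥ z ∥
    4κ< = ℕ.≤-trans (ℕ.m≤n+m _ 2) (ℕ.+-cancelˡ-≤ ∥ b ∥ _ _ (ℕ.≤-trans (ℕ.+-monoˡ-≤ _ b≤)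
      (ℕ.≤-trans t≤ (ℕ.≤-reflexive (trans (↭-length (word-+ᵛ as b z)) (List.length-++ (word as b)))))))
  ...   | d , rest , z↭ = b′ +ᵛ z , ≺-+ᵛ z b′≺b , size′ ,
    M.trans (↭⇒∼ (word-+ᵛ as b′ z)) (M.trans (∼-++ b′∼b M.refl) (M.sym (↭⇒∼ (word-+ᵛ as b z)))) ,
    ↭⇒≈* [] (split b) (long t≤) ◅◅ EqClosure.return middle ◅◅
    EqClosure.symmetric _ (↭⇒≈* [] (split b′) (long (subst (threshold ≤_) (sym size′) t≤)))
    where
    size′ : ∥ b′ +ᵛ z ∥ ≡ ∥ b +ᵛ z ∥
    size′ = trans (trans (↭-length (word-+ᵛ as b′ z)) (List.length-++ (word as b′)))
      (trans (cong (_+ ∥ z ∥) size≡) (sym (trans (↭-length (word-+ᵛ as b z)) (List.length-++ (word as b)))))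

    split : ∀ b → word as (b +ᵛ z) ↭ List.replicate 5 d List.++ word as b List.++ rest
    split b = ↭-trans (word-+ᵛ as b z) (↭-trans (++⁺ˡ (word as b) z↭) (shifts (word as b) (List.replicate 5 d)))

    middle : Step (List.replicate 5 d List.++ word as b List.++ rest) (List.replicate 5 d List.++ word as b′ List.++ rest)
    middle with zipped (word as b List.++ rest) (word as b′ List.++ rest)
                  (trans (List.length-++ (word as b)) (trans (cong (_+ _) (sym size≡)) (sym (List.length-++ (word as b′)))))
    ... | zs , row₁ , row₂ = step {columns = List.replicate 5 (d , d) List.++ zs}
      (cong (List.replicate 5 d List.++_) row₁) (cong (List.replicate 5 d List.++_) row₂) d {zs} ↭-refl
      (subst₂ _∼_ row₁ row₂ (∼-++ (M.sym b′∼b) M.refl))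

  -- Induction on the larger vector x. It is reduced to some x′; then y and x′ both precede x and
  -- have its length and weight, so the induction applies to whichever of them is larger.
  words-connected : ∀ {x} → Acc _≺_ x → ∀ {y} → y ≺ x ⊎ y ≡ x → ∥ y ∥ ≡ ∥ x ∥ → threshold ≤ ∥ x ∥ →
                    word as y ∼ word as x → word as x ≈* word as y
  words-connected _ (inj₂ refl) _ _ _ = ε
  words-connected {x} (acc rec) {y} (inj₁ y≺x) size≡ t≤ y∼x with reduce (y , y≺x , size≡ , y∼x) t≤
  ... | x′ , x′≺x , size′ , x′∼x , x≈*x′ = x≈*x′ ◅◅ compare (≺-cmp y x′)
    where
    t≤x′ = subst (threshold ≤_) (sym size′) t≤
    t≤y = subst (threshold ≤_) (sym size≡) t≤

    compare : y ≺ x′ ⊎ y ≡ x′ ⊎ x′ ≺ y → word as x′ ≈* word as y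
    compare (inj₁ y≺x′) = words-connected (rec x′≺x) (inj₁ y≺x′) (trans size≡ (sym size′)) t≤x′ (M.trans y∼x (M.sym x′∼x))
    compare (inj₂ (inj₁ refl)) = ε
    compare (inj₂ (inj₂ x′≺y)) = EqClosure.symmetric _
      (words-connected (rec y≺x) (inj₁ x′≺y) (trans size′ (sym size≡)) t≤y (M.trans x′∼x (M.sym y∼x)))

  ∼⇒≈* : ∀ {xs ys} → threshold ≤ length xs → length xs ≡ length ys → xs ∼ ys → xs ≈* ys
  ∼⇒≈* {xs} {ys} t≤ len xs∼ys with parikh xs | parikh ys
  ... | x , xs↭ | y , ys↭ = ↭⇒≈* [] xs↭ (long t≤) ◅◅ connected (≺-cmp x y) ◅◅
      EqClosure.symmetric _ (↭⇒≈* [] ys↭ (long (subst (threshold ≤_) len t≤)))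
    where
    x∼y : word as x ∼ word as y
    x∼y = M.trans (M.sym (↭⇒∼ xs↭)) (M.trans xs∼ys (↭⇒∼ ys↭))

    size≡ : ∥ x ∥ ≡ ∥ y ∥
    size≡ = trans (sym (↭-length xs↭)) (trans len (↭-length ys↭))

    t≤x = subst (threshold ≤_) (↭-length xs↭) t≤

    connected : x ≺ y ⊎ x ≡ y ⊎ y ≺ x → word as x ≈* word as y
    connected (inj₁ x≺y)         = EqClosure.symmetric _ (words-connected (≺-wellFounded y) (inj₁ x≺y) size≡ (subst (threshold ≤_) size≡ t≤x) x∼y)
    connected (inj₂ (inj₁ refl)) = ε
    connected (inj₂ (inj₂ y≺x))  = words-connected (≺-wellFounded x) (inj₁ y≺x) (sym size≡) t≤x (M.sym x∼y)

  -- The generating set and the induction on the arity.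

  record Admissible (t : Vec A n × Vec A n × Vec A n) : Set (a ⊔ ℓ) where
    constructor admissible
    field
      1∼2        : proj₁ t ∼ᵛ proj₁ (proj₂ t)
      2∼3        : proj₁ (proj₂ t) ∼ᵛ proj₂ (proj₂ t)
      isDistinct : Distinct (proj₁ t) (proj₁ (proj₂ t)) (proj₂ (proj₂ t))

  admissible? : (t : Vec A n × Vec A n × Vec A n) → Dec (Admissible t)
  admissible? (x , y , z) =
    map′ (λ (x∼y , y∼z , p , q , r) → admissible x∼y y∼z (distinct p q r))
         (λ (admissible x∼y y∼z (distinct p q r)) → x∼y , y∼z , p , q , r)
         (x ∼ᵛ? y ×-dec y ∼ᵛ? z ×-dec ¬? (x ≟ y) ×-dec ¬? (y ≟ z) ×-dec ¬? (x ≟ z))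

  cycleGate : ∀ {t : Vec A (suc n) × Vec A (suc n) × Vec A (suc n)} → Admissible t → Gate A
  cycleGate {t = x , y , z} (admissible _ _ d) =
    gate (mk↔ₛ′ (cycle x y z) (cycle x z y) (cycle-inverse d) (cycle-inverse (reflect d)))

  cycleGates : Vec A (suc n) × Vec A (suc n) × Vec A (suc n) → List (Gate A)
  cycleGates t with admissible? t
  ... | yes t-ok = cycleGate t-ok ∷ []
  ... | no  _    = []

  triples : ∀ n → List (Vec A n × Vec A n × Vec A n)
  triples n = List.cartesianProduct ws (List.cartesianProduct ws ws)
    where ws = wordsOfLength (letters finite) n

  -- The index i runs from 0 to `threshold`, so the arities run from 1 to `threshold` + 1.
  generators : List (Gate A)
  generators = List.concatMap (λ i → List.concatMap cycleGates (triples (suc i))) (List.upTo (suc threshold))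

  generators⊆ECons : ∀ {g} → g ∈ generators → ECons M φ (Finite⇒≟ finite) g
  generators⊆ECons g∈ with Any.satisfied (∈-concatMap⁻ _ {xs = List.upTo (suc threshold)} g∈)
  ... | i , g∈ᵢ with Any.satisfied (∈-concatMap⁻ _ {xs = triples (suc i)} g∈ᵢ)
  ...   | t , g∈ₜ with admissible? t
  ...     | yes (admissible x∼y y∼z d) with here refl ← g∈ₜ = cycle-evenConservative x∼y y∼z d
  ...     | no _ with () ← g∈ₜ

  private
    P : Pred (Gate A) a
    P g = g ∈ generators

  generated-cycles : ∀ {i} → i < suc threshold → AllCyclesRealised P (suc i)
  generated-cycles {i} i≤ {x} {y} {z} x∼y y∼z d with admissible? (x , y , z) in eq
  ... | no ¬ok = contradiction (admissible x∼y y∼z d) ¬ok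
  ... | yes ok = _ , gen (∈-concatMap⁺ _ (Any.map (λ { refl → ∈-concatMap⁺ _ (Any.map (λ { refl → found }) t∈) }) (∈-upTo⁺ i≤))) , λ _ → refl
    where
    word∈ : ∀ x → x ∈ wordsOfLength (letters finite) (suc i)
    word∈ = ∈-wordsOfLength (∈-letters finite)

    t∈ : (x , y , z) ∈ triples (suc i)
    t∈ = ∈-cartesianProduct⁺ (word∈ x) (∈-cartesianProduct⁺ (word∈ y) (word∈ z))

    found : cycleGate ok ∈ cycleGates (x , y , z)
    found rewrite eq = here refl

  extended-cycles : ∀ {i} → threshold ≤ suc (suc i) → AllCyclesRealised P (suc i) → AllCyclesRealised P (suc (suc i))
  extended-cycles t≤ cycles = joined⇒cycles P λ {x} {y} x∼y →
    steps⇒joined P (λ { refl → cycles })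
      (∼⇒≈* (subst (threshold ≤_) (sym (length-toList x)) t≤)
            (trans (length-toList x) (sym (length-toList y))) x∼y)
      x y refl refl

  -- Up to arity `threshold` + 1 the 3-cycles are generators. Above it the words are long enough for
  -- their weight classes to be connected, and the links come from the 3-cycles of arity one less.
  all-cycles : ∀ n .{{_ : NonZero n}} → AllCyclesRealised P n
  all-cycles (suc i) with i ℕ.<? suc threshold
  ... | yes i< = generated-cycles i<
  all-cycles (suc zero)    | no 0≮ = contradiction ℕ.z<s 0≮
  all-cycles (suc (suc i)) | no i≮ = extended-cycles t≤ (all-cycles (suc i))
    where
    t≤ : threshold ≤ suc (suc i)
    t≤ = ℕ.m≤n⇒m≤1+n (ℕ.≤-trans (ℕ.n≤1+n _) (ℕ.≮⇒≥ i≮))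
  all-cycles zero {[]} {[]} _ _ d = contradiction refl (Distinct.1≢2 d)

  finitelyGenerated : ⌈ P ⌉ ≐ ECons M φ (Finite⇒≟ finite)
  finitelyGenerated = revital⊆ECons generators⊆ECons ,
    λ {g} g∈ → realised⇒∈ (bij g) (evenConservative⇒∈ realised-closed (all-cycles (arity g)) g∈)

theorem24 : ∀ {a c ℓ} → ExcludedMiddle (a ⊔ c ⊔ ℓ) →
    {A : Set a} (finite : Finite A) (M : CommutativeMonoid c ℓ)
    (φ : List A → CommutativeMonoid.Carrier M) →
    IsMonoidHomomorphism (++-[]-rawMonoid A) (CommutativeMonoid.rawMonoid M) φ →
    ∃ λ (P : List (Gate A)) → ⌈ (λ g → g ∈ P) ⌉ ≐ ECons M φ (Finite⇒≟ finite)
theorem24 {a} {c} em finite M φ hom = generators , finitelyGenerated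
  -- Excluded middle decides equality of weights and the case distinctions in Dickson's lemma. These
  -- live at level ℓ and are lifted to the level of `em`.
  where open Conservation (λ Q → map′ lower lift (em {Lift (a ⊔ c) Q})) finite M φ hom
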